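{- Let $s\in[\tfrac14,\tfrac12]$, let $P\subset\mathbb{F}_q^d$ be a $(4,s)$-Salem set and let $H$ be a set of hyperplanes in $\mathbb{F}_q^d$ defined by $\mathbf{a}\cdot\mathbf{x}=b$ with $\mathbf{a}\ne\mathbf{0}$ and $b\ne0$. Then $$I(P,H)\le\frac{|P|\,|H|}{q}+|H|^{\frac34}q^{\frac{d-1}{4}}|P|^{1-s}.$$
   Context: $\mathbb{F}_q$ is a finite field with $q$ elements. $I(P,H)$ is the number of incidences, i.e. of pairs $(\mathbf{x},h)\in P\times H$ with $\mathbf{x}\in h$. Fix a nontrivial additive character $\chi$ of $\mathbb{F}_q$ and put $\widehat{P}(\mathbf{x})=q^{ -d}\sum_{\mathbf{y}\in P}\chi(-\mathbf{x}\cdot\mathbf{y})$ and $\|\widehat{P}\|_4=\big(q^{ -d}\sum_{\mathbf{x}\in\mathbb{F}_q^d\setminus\{\mathbf{0}\}}|\widehat{P}(\mathbf{x})|^4\big)^{1/4}$. The set $P$ is $(4,s)$-Salem if $\|\widehat{P}\|_4\ll q^{ -d}|P|^{1-s}$, where $A\ll B$ means that there is an absolute constant $C>0$ such that $A\le CB$.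
   Formalization: The constant C implied by ≪ in the Salem condition multiplies the second term of the bound; with constant 1 the claim fails (P a line in F_16² missing 0, H={P}, s=1/2, C=2: I=16, bound 9), and C=1 gives the displayed inequality. -}

module Defs where

open import Algebra.Apartness.Bundles using (HeytingField)
import Algebra.Apartness.Properties.HeytingCommutativeRing as HeytingProperties
open import Algebra.Bundles using (CommutativeRing; Semiring)
import Algebra.Definitions.RawSemiring as RawSemiringDefs
import Algebra.Properties.Ring as RingProperties
open import Data.Fin.Base using (Fin)
import Data.Fin.Properties as Fin
open import Data.List.Base as List using (List; foldr; filter; length; allFin; cartesianProduct; cartesianProductWith)
open import Data.List.Relation.Unary.All using (All)
open import Data.List.Relation.Unary.AllPairs using (AllPairs)
import Data.List.Relation.Unary.Unique.Setoid as Unique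
open import Data.Nat.Base as ℕ using (ℕ; zero; suc; NonZero)
open import Data.Product.Base using (∃; _,_; _×_; proj₁; proj₂; uncurry)
open import Data.Sum.Base using (_⊎_; inj₁; inj₂)
open import Data.Vec.Base as Vec using (Vec; []; _∷_; replicate; zipWith)
import Data.Vec.Relation.Binary.Equality.DecSetoid as VecEquality
open import Function.Bundles using (Inverse)
open import Function.Properties.Inverse using (Inverse⇒Injection)
open import Level using (Level; _⊔_) renaming (suc to lsuc)
open import Relation.Binary.Bundles using (DecSetoid)
open import Relation.Binary.Core using (Rel)
open import Relation.Binary.Definitions using (Decidable)
open import Relation.Binary.Structures using (IsStrictPartialOrder)
import Relation.Binary.PropositionalEquality.Core as ≡
import Relation.Binary.PropositionalEquality.Properties as ≡
open import Relation.Nullary.Decidable using (Dec; ¬?; via-injection)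
open import Relation.Nullary.Negation using (¬_; contradiction)
open import Relation.Unary using (Pred; _≐_)

-- The real numbers, as a Cauchy complete Archimedean ordered field.
-- Classically this determines ℝ up to unique isomorphism; excluded middle is
-- not built in, so that constructive reals are also covered.

record RealField c ℓ₁ ℓ₂ : Set (lsuc (c ⊔ ℓ₁ ⊔ ℓ₂)) where
  field
    heytingField : HeytingField c ℓ₁ ℓ₂

  open HeytingField heytingField public

  infix 4 _<_ _≤_

  field
    _<_                  : Rel Carrier ℓ₂
    isStrictPartialOrder : IsStrictPartialOrder _≈_ _<_
    #⇒<⊎>                : ∀ {x y} → x # y → x < y ⊎ y < x
    <⇒#                  : ∀ {x y} → x < y → x # y
    +-monoˡ-<            : ∀ {x y} z → x < y → x + z < y + z
    *-positive           : ∀ {x y} → 0# < x → 0# < y → 0# < x * y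

  open IsStrictPartialOrder isStrictPartialOrder public
    using (<-resp-≈; <-respˡ-≈; <-respʳ-≈)
    renaming (irrefl to <-irrefl; trans to <-trans; asym to <-asym)

  _≤_ : Rel Carrier ℓ₂
  x ≤ y = ¬ (y < x)

  commutativeRing : CommutativeRing c ℓ₁
  commutativeRing = record { isCommutativeRing = isCommutativeRing }

  open RawSemiringDefs (Semiring.rawSemiring (CommutativeRing.semiring commutativeRing)) public
    using (_^_)
    renaming (_×_ to _×#_)

  fromℕ : ℕ → Carrier
  fromℕ n = n ×# 1#

  Cauchy : (ℕ → Carrier) → Set (c ⊔ ℓ₂)
  Cauchy u = ∀ ε → 0# < ε → ∃ λ N → ∀ m n → N ℕ.≤ m → N ℕ.≤ n → u m - u n < ε

  _ConvergesTo_ : (ℕ → Carrier) → Carrier → Set (c ⊔ ℓ₂)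
  u ConvergesTo l =
    ∀ ε → 0# < ε → ∃ λ N → ∀ n → N ℕ.≤ n → u n - l < ε × l - u n < ε

  field
    archimedean : ∀ x → ∃ λ n → x < fromℕ n
    complete    : ∀ u → Cauchy u → ∃ λ l → u ConvergesTo l

  private
    open RingProperties (CommutativeRing.ring commutativeRing)
      using (-‿distribˡ-*; -0#≈0#; -‿involutive)
    open HeytingProperties (HeytingField.heytingCommutativeRing heytingField)
      using (1#0; x-0≈x; invertibleˡ⇒#)

    x<0⇒0<-x : ∀ {x} → x < 0# → 0# < - x
    x<0⇒0<-x {x} x<0 =
      <-respˡ-≈ (-‿inverseʳ x) (<-respʳ-≈ (+-identityˡ (- x)) (+-monoˡ-< (- x) x<0))

  0<1 : 0# < 1#
  0<1 with #⇒<⊎> 1#0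
  ... | inj₂ 0<1 = 0<1
  ... | inj₁ 1<0 = <-respʳ-≈ -1*-1≈1 (*-positive (x<0⇒0<-x 1<0) (x<0⇒0<-x 1<0))
    where
    -1*-1≈1 : - 1# * - 1# ≈ 1#
    -1*-1≈1 = trans (sym (-‿distribˡ-* 1# (- 1#)))
                    (trans (-‿cong (*-identityˡ (- 1#))) (-‿involutive 1#))

  0<fromℕ : ∀ n .{{_ : NonZero n}} → 0# < fromℕ n
  0<fromℕ (suc zero)    = <-respʳ-≈ (sym (+-identityʳ 1#)) 0<1
  0<fromℕ (suc (suc n)) =
    <-trans 0<1 (<-respˡ-≈ (+-identityˡ 1#)
      (<-respʳ-≈ (+-comm (fromℕ (suc n)) 1#) (+-monoˡ-< 1# (0<fromℕ (suc n)))))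

  infix 9 1/_

  1/_ : ∀ n .{{_ : NonZero n}} → Carrier
  1/ n = proj₁ (#⇒invertible {fromℕ n} {0#} (#-sym (<⇒# (0<fromℕ n))))

  1/n*n≈1 : ∀ n .{{_ : NonZero n}} → 1/ n * fromℕ n ≈ 1#
  1/n*n≈1 n = trans (*-congˡ (sym (x-0≈x (fromℕ n))))
    (proj₁ (proj₂ (#⇒invertible {fromℕ n} {0#} (#-sym (<⇒# (0<fromℕ n))))))

  0<1/n : ∀ n .{{_ : NonZero n}} → 0# < 1/ n
  0<1/n n with #⇒<⊎> {1/ n} {0#} (invertibleˡ⇒# (fromℕ n ,
                 trans (*-congˡ (x-0≈x (1/ n))) (trans (*-comm (fromℕ n) (1/ n)) (1/n*n≈1 n))))
  ... | inj₂ 0<y = 0<y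
  ... | inj₁ y<0 = contradiction 1<0 (<-asym 0<1)
    where
    0<-1 : 0# < - 1#
    0<-1 = <-respʳ-≈
      (trans (sym (-‿distribˡ-* (1/ n) (fromℕ n))) (-‿cong (1/n*n≈1 n)))
      (*-positive (x<0⇒0<-x y<0) (0<fromℕ n))

    1<0 : 1# < 0#
    1<0 = <-respˡ-≈ (+-identityˡ 1#)
      (<-respʳ-≈ (-‿inverseˡ 1#) (+-monoˡ-< 1# 0<-1))

  ¼ ½ ¾ : Carrier
  ¼ = 1/ 4
  ½ = 1/ 2
  ¾ = fromℕ 3 * ¼

-- Real powers x ^ r, for x > 0 and any r, or for x ≥ 0 and r > 0.  There the
-- laws determine the value: for x ≥ 1 they fix rational powers, and then real
-- ones by monotonicity in r; 0 < x < 1 reduces to 1/x by pow-*.  The two cases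
-- of the domain cannot be told apart constructively, whence the evidence Dom
-- (on which, by pow-cong, the value does not depend).  For x < 0 < r the value
-- is unspecified.

record RealPower {c ℓ₁ ℓ₂} (ℝ : RealField c ℓ₁ ℓ₂) : Set (c ⊔ ℓ₁ ⊔ ℓ₂) where
  open RealField ℝ

  Dom : Rel Carrier ℓ₂
  Dom x r = 0# < x ⊎ 0# < r

  field
    pow        : ∀ x r → Dom x r → Carrier
    pow-cong   : ∀ {x y r t} (p : Dom x r) (p′ : Dom y t) →
                 x ≈ y → r ≈ t → pow x r p ≈ pow y t p′
    pow-nonneg : ∀ {x r} (p : Dom x r) → 0# ≤ x → 0# ≤ pow x r p
    pow-1      : ∀ {x} (p : Dom x 1#) → 0# ≤ x → pow x 1# p ≈ x
    pow-+      : ∀ {x r t} (p : Dom x (r + t)) (p₁ : Dom x r) (p₂ : Dom x t) →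
                 0# ≤ x → pow x (r + t) p ≈ pow x r p₁ * pow x t p₂
    pow-*      : ∀ {x y r} (p : Dom (x * y) r) (p₁ : Dom x r) (p₂ : Dom y r) →
                 0# ≤ x → 0# ≤ y → pow (x * y) r p ≈ pow x r p₁ * pow y r p₂
    pow-monoʳ  : ∀ {x r t} (p : Dom x r) (p′ : Dom x t) →
                 1# ≤ x → r ≤ t → pow x r p ≤ pow x t p′

  infixr 8 _^ᵣ_

  -- The value 0 ^ r = 0 is the right one for r > 0 only.
  _^ᵣ_ : ℕ → Carrier → Carrier
  zero  ^ᵣ r = 0#
  suc n ^ᵣ r = pow (fromℕ (suc n)) r (inj₁ (0<fromℕ (suc n)))

  -- Meaningful for x ≥ 0.
  root : ∀ k .{{_ : NonZero k}} → Carrier → Carrier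
  root k x = pow x (1/ k) (inj₂ (0<1/n k))

module Complex {c ℓ₁ ℓ₂} (ℝ : RealField c ℓ₁ ℓ₂) (power : RealPower ℝ) where
  open RealField ℝ
  open RealPower power

  infix  4 _≈ᶜ_
  infixl 6 _+ᶜ_
  infixl 7 _*ᶜ_ _·ᶜ_

  record ℂ : Set c where
    constructor _+i_
    field
      re im : Carrier

  open ℂ public

  _≈ᶜ_ : Rel ℂ ℓ₁
  z ≈ᶜ w = re z ≈ re w × im z ≈ im w

  0ᶜ 1ᶜ : ℂ
  0ᶜ = 0# +i 0#
  1ᶜ = 1# +i 0#

  _+ᶜ_ _*ᶜ_ : ℂ → ℂ → ℂ
  z +ᶜ w = (re z + re w) +i (im z + im w)
  z *ᶜ w = (re z * re w - im z * im w) +i (re z * im w + im z * re w)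

  _·ᶜ_ : Carrier → ℂ → ℂ
  r ·ᶜ z = (r * re z) +i (r * im z)

  ∣_∣ : ℂ → Carrier
  ∣ z ∣ = root 2 (re z * re z + im z * im z)

record FiniteField a ℓ (q : ℕ) : Set (lsuc (a ⊔ ℓ)) where
  field
    commutativeRing : CommutativeRing a ℓ

  open CommutativeRing commutativeRing public

  field
    1≉0         : ¬ (1# ≈ 0#)
    inverse     : ∀ x → ¬ (x ≈ 0#) → ∃ λ y → x * y ≈ 1#
    enumeration : Inverse setoid (≡.setoid (Fin q))

  infix 4 _≟_

  _≟_ : Decidable _≈_
  _≟_ = via-injection (Inverse⇒Injection enumeration) Fin._≟_

  decSetoid : DecSetoid a ℓ
  decSetoid = record
    { isDecEquivalence = record { isEquivalence = isEquivalence ; _≟_ = _≟_ } }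

  order-nonZero : NonZero q
  order-nonZero = Fin.nonZeroIndex (Inverse.to enumeration 0#)

  elements : List Carrier
  elements = List.map (Inverse.from enumeration) (allFin q)

module AffineSpace {a ℓ} {q : ℕ} (𝔽 : FiniteField a ℓ q) where
  private module 𝔽 = FiniteField 𝔽
  open VecEquality 𝔽.decSetoid public using (_≋_; _≋?_; ≋-setoid)

  Point : ℕ → Set a
  Point d = Vec 𝔽.Carrier d

  origin : ∀ d → Point d
  origin d = replicate d 𝔽.0#

  infix 8 _∙_

  _∙_ : ∀ {d} → Point d → Point d → 𝔽.Carrier
  x ∙ y = Vec.foldr′ 𝔽._+_ 𝔽.0# (zipWith 𝔽._*_ x y)

  allPoints : ∀ d → List (Point d)
  allPoints zero    = List.[ [] ]
  allPoints (suc d) = cartesianProductWith _∷_ 𝔽.elements (allPoints d)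

  nonzeroPoints : ∀ d → List (Point d)
  nonzeroPoints d = filter (λ x → ¬? (x ≋? origin d)) (allPoints d)

  record PointSet (d : ℕ) : Set (a ⊔ ℓ) where
    field
      points   : List (Point d)
      distinct : Unique.Unique (≋-setoid d) points

  record Hyperplane (d : ℕ) : Set (a ⊔ ℓ) where
    field
      normal   : Point d
      normal≉0 : ¬ (normal ≋ origin d)
      offset   : 𝔽.Carrier

  open Hyperplane public

  infix 4 _∈ₕ_ _∈ₕ?_

  _∈ₕ_ : ∀ {d} → Point d → Hyperplane d → Set ℓ
  x ∈ₕ h = normal h ∙ x 𝔽.≈ offset h

  _∈ₕ?_ : ∀ {d} (x : Point d) (h : Hyperplane d) → Dec (x ∈ₕ h)
  x ∈ₕ? h = normal h ∙ x 𝔽.≟ offset h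

  -- Hyperplanes are identified when they contain the same points, so a set
  -- does not list proportional equations of one hyperplane.
  record HyperplaneSet (d : ℕ) : Set (a ⊔ ℓ) where
    field
      hyperplanes : List (Hyperplane d)
      distinct    : AllPairs (λ h h′ → ¬ ((_∈ₕ h) ≐ (_∈ₕ h′))) hyperplanes

  open PointSet public using (points)
  open HyperplaneSet public using (hyperplanes)

  #ᴾ : ∀ {d} → PointSet d → ℕ
  #ᴾ P = length (points P)

  #ᴴ : ∀ {d} → HyperplaneSet d → ℕ
  #ᴴ H = length (hyperplanes H)

  incidences : ∀ {d} → PointSet d → HyperplaneSet d → ℕ
  incidences P H =
    length (filter (uncurry _∈ₕ?_) (cartesianProduct (points P) (hyperplanes H)))

  NonzeroOffsets : ∀ {d} → HyperplaneSet d → Set (a ⊔ ℓ)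
  NonzeroOffsets H = All (λ h → ¬ (offset h 𝔽.≈ 𝔽.0#)) (hyperplanes H)

module Fourier
  {c ℓ₁ ℓ₂ a ℓ} (ℝ : RealField c ℓ₁ ℓ₂) (power : RealPower ℝ)
  {q : ℕ} (𝔽 : FiniteField a ℓ q)
  where

  open RealField ℝ public
    using (_≤_; _<_; _+_; _*_; _-_; _^_; 0#; 1#; fromℕ; ¼; ½; ¾)
    renaming (Carrier to Real)
  open RealField ℝ using (1/_)
  open RealPower power public using (_^ᵣ_)
  open RealPower power using (root)
  open Complex ℝ power public
  open AffineSpace 𝔽 public
  private module 𝔽 = FiniteField 𝔽

  q⁻¹ : Real
  q⁻¹ = 1/_ q {{𝔽.order-nonZero}}

  record NontrivialAdditiveCharacter : Set (c ⊔ ℓ₁ ⊔ a ⊔ ℓ) where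
    field
      χ          : 𝔽.Carrier → ℂ
      χ-cong     : ∀ {x y} → x 𝔽.≈ y → χ x ≈ᶜ χ y
      χ-0        : χ 𝔽.0# ≈ᶜ 1ᶜ
      χ-+        : ∀ x y → χ (x 𝔽.+ y) ≈ᶜ χ x *ᶜ χ y
      nontrivial : ∃ λ x → ¬ (χ x ≈ᶜ 1ᶜ)

  module _ (character : NontrivialAdditiveCharacter) where
    open NontrivialAdditiveCharacter character

    fourier : ∀ {d} → PointSet d → Point d → ℂ
    fourier {d} P x =
      (q⁻¹ ^ d) ·ᶜ foldr (λ y z → χ (𝔽.- (x ∙ y)) +ᶜ z) 0ᶜ (points P)

    fourierNorm₄ : ∀ {d} → PointSet d → Real
    fourierNorm₄ {d} P =
      root 4 ((q⁻¹ ^ d) * foldr (λ x r → ∣ fourier P x ∣ ^ 4 + r) 0# (nonzeroPoints d))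

    -- (4, s)-Salem, with C as the constant implied by ≪.
    IsSalem₄ : ∀ {d} → Real → Real → PointSet d → Set ℓ₂
    IsSalem₄ {d} C s P =
      fourierNorm₄ P ≤ C * ((q⁻¹ ^ d) * (#ᴾ P ^ᵣ (1# - s)))

{-# OPTIONS --safe #-}
module Submission where

-- Dividing the equation of a hyperplane by its offset gives it the form v · x = 1, with
-- distinct v for distinct hyperplanes.  Expanding the incidence indicator in additive
-- characters, q I(P,H) is |P||H| plus Σ_v Σ_{t≠0} χ(t) S(t v), where S(x) is the sum over
-- y ∈ P of χ(−x · y).  This is the inner product of S with the weight G(x), the sum of
-- χ(t) over the (v, t) with t v = x.  The support of G has at most q|H| points, and
-- orthogonality gives Σ|G|² ≤ q|H|, because two different parallel vectors v contribute
-- −1.  Hence Cauchy–Schwarz, used twice, bounds the fourth power of the inner product by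
-- (q|H|)³ Σ_{x≠0}|S(x)|⁴, and the Salem condition bounds the last sum.

-- Parallel normals are the obstacle. Up to q - 1 of the vectors v can lie on one line through the
-- origin; the points t v then coincide for many pairs (v, t), and Hölder's inequality over the
-- pairs would count |S(x)|⁴ with that multiplicity. Collecting the weights at each x first lets the
-- phases cancel: the pairs with v = r v′ contribute the sum of χ(t(1 - r)) over t ≠ 0, whose
-- negative values for r ≠ 1 may be dropped from an upper bound, so only the diagonal is left. No
-- point t v is the origin, which fits the omission of the origin from the norm. The exponent (d -
-- 1)/4 comes from (q|H|)³ q^d = q⁴ · |H|³ q^(d-1): the factor q⁴ is absorbed by the q in front of
-- I(P,H), and the Salem constant C passes through unchanged. Since the order on the reals is not
-- assumed decidable, inequalities are negated strict ones and the main estimate is a comparison of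
-- fourth powers. Complex sums are handled as pairs of real ones; the count of incidences is real,
-- so only real parts are needed there.

open import Defs
open import Algebra.Bundles using (CommutativeRing)
import Algebra.Apartness.Properties.HeytingCommutativeRing as HeytingProperties
import Algebra.Properties.AbelianGroup as AbelianGroupProperties
import Algebra.Properties.Group as GroupProperties
import Algebra.Properties.Ring as RingProperties
import Algebra.Properties.Semiring.Exp as SemiringExp
import Algebra.Properties.Semiring.Mult.TCOptimised as SemiringMult
import Algebra.Solver.Ring as RingSolver
open import Algebra.Solver.Ring.AlmostCommutativeRing
  using (fromCommutativeRing; _-Raw-AlmostCommutative⟶_)
open import Data.Integer.Base as ℤ using (ℤ; +_; -[1+_])
import Data.Integer.Properties as ℤ
open import Data.List.Base as List
  using (List; []; _∷_; _++_; foldr; filter; length; allFin; cartesianProduct)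
import Data.List.Membership.Setoid as Membership
open import Data.List.Membership.Propositional.Properties using (∈-allFin)
open import Data.List.Membership.Setoid.Properties
  using (∈-resp-≈; ∈-map⁺; ∈-filter⁺; ∈-cartesianProductWith⁺)
import Data.List.Properties as List
open import Data.List.Relation.Unary.All as All using (All; []; _∷_; tabulateₛ)
import Data.List.Relation.Unary.All.Properties as All
open import Data.List.Relation.Unary.AllPairs as AllPairs using (AllPairs; []; _∷_)
open import Data.List.Relation.Unary.Any as Any using (Any; here; there)
import Data.List.Relation.Unary.Unique.Propositional.Properties as Uniqueₚ using (allFin⁺)
import Data.List.Relation.Unary.Unique.Setoid as Unique
import Data.List.Relation.Unary.Unique.Setoid.Properties as Uniqueₚ
  using (map⁺; filter⁺; cartesianProductWith⁺)
open import Data.Maybe.Base using (Maybe) renaming (map to mapMaybe)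
open import Data.Nat.Base as ℕ using (ℕ; zero; suc; z≤n; s≤s)
import Data.Nat.Properties as ℕ
open import Data.Product.Base as Product using (_,_; proj₁; proj₂; uncurry)
open import Data.Sum.Base as Sum using (_⊎_; inj₁; inj₂)
open import Data.Vec.Base as Vec using (Vec; []; _∷_)
import Data.Vec.Relation.Binary.Equality.DecSetoid as VecEquality
open import Data.Vec.Relation.Binary.Pointwise.Inductive using ([]; _∷_)
open import Function.Bundles using (Inverse)
open import Level using (Level)
open import Relation.Binary.Bundles using (DecSetoid; Setoid)
open import Relation.Binary.Consequences using (dec⇒weaklyDec)
import Relation.Binary.PropositionalEquality as ≡
open import Relation.Binary.PropositionalEquality using (_≡_)
import Relation.Binary.Reasoning.Setoid as SetoidReasoning
open import Relation.Nullary.Decidable using (Dec; yes; no; ¬?)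
open import Relation.Nullary.Negation using (¬_; contradiction)
open import Relation.Unary using (Pred; Decidable; _≐_)

-- The library's ring solver needs decidable coefficients to recognise
-- cancellation, so ℤ is used rather than the ring itself.
module IntegerSolver {r₁ r₂} (R : CommutativeRing r₁ r₂) where
  open CommutativeRing R
  open RingProperties ring
  open AbelianGroupProperties +-abelianGroup using (⁻¹-∙-comm)
  open SemiringMult semiring
  open SetoidReasoning setoid

  -- The multiple `_×_` is the variant for which `1 × 1#` computes to `1#`, so `con (+ 0)` and
  -- `con (+ 1)` mean `0#` and `1#` definitionally in every solver equation.
  ⟦_⟧ℤ : ℤ → Carrier
  ⟦ + n      ⟧ℤ = n × 1#
  ⟦ -[1+ n ] ⟧ℤ = - (suc n × 1#)

  ⟦⟧-neg : ∀ i → ⟦ ℤ.- i ⟧ℤ ≈ - ⟦ i ⟧ℤ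
  ⟦⟧-neg (+ zero)   = sym -0#≈0#
  ⟦⟧-neg (+ suc n)  = refl
  ⟦⟧-neg -[1+ n ]   = sym (-‿involutive _)

  ⟦⟧-⊖ : ∀ m n → ⟦ m ℤ.⊖ n ⟧ℤ ≈ m × 1# - n × 1#
  ⟦⟧-⊖ m       zero    = sym (trans (+-congˡ -0#≈0#) (+-identityʳ _))
  ⟦⟧-⊖ zero    (suc n) = sym (+-identityˡ _)
  ⟦⟧-⊖ (suc m) (suc n) = begin
    ⟦ suc m ℤ.⊖ suc n ⟧ℤ                 ≡⟨ ≡.cong ⟦_⟧ℤ (ℤ.[1+m]⊖[1+n]≡m⊖n m n) ⟩
    ⟦ m ℤ.⊖ n ⟧ℤ                         ≈⟨ ⟦⟧-⊖ m n ⟩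
    m × 1# - n × 1#                      ≈⟨ +-congʳ (+-identityˡ _) ⟨
    (0# + m × 1#) - n × 1#               ≈⟨ +-congʳ (+-congʳ (-‿inverseʳ 1#)) ⟨
    ((1# - 1#) + m × 1#) - n × 1#        ≈⟨ +-congʳ (+-assoc _ _ _) ⟩
    (1# + (- 1# + m × 1#)) - n × 1#      ≈⟨ +-congʳ (+-congˡ (+-comm _ _)) ⟩
    (1# + (m × 1# - 1#)) - n × 1#        ≈⟨ +-congʳ (+-assoc _ _ _) ⟨
    ((1# + m × 1#) - 1#) - n × 1#        ≈⟨ +-assoc _ _ _ ⟩
    (1# + m × 1#) + (- 1# - n × 1#)      ≈⟨ +-cong (sym (1+× m 1#)) (⁻¹-∙-comm _ _) ⟩
    suc m × 1# - (1# + n × 1#)           ≈⟨ +-congˡ (-‿cong (1+× n 1#)) ⟨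
    suc m × 1# - suc n × 1#              ∎

  ⟦⟧-+ : ∀ i j → ⟦ i ℤ.+ j ⟧ℤ ≈ ⟦ i ⟧ℤ + ⟦ j ⟧ℤ
  ⟦⟧-+ (+ m)    (+ n)    = ×-homo-+ 1# m n
  ⟦⟧-+ (+ m)    -[1+ n ] = ⟦⟧-⊖ m (suc n)
  ⟦⟧-+ -[1+ m ] (+ n)    = trans (⟦⟧-⊖ n (suc m)) (+-comm _ _)
  ⟦⟧-+ -[1+ m ] -[1+ n ] = begin
    - (suc (suc (m ℕ.+ n)) × 1#)       ≡⟨ ≡.cong (λ k → - (suc k × 1#)) (≡.sym (ℕ.+-suc m n)) ⟩
    - ((suc m ℕ.+ suc n) × 1#)         ≈⟨ -‿cong (×-homo-+ 1# (suc m) (suc n)) ⟩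
    - (suc m × 1# + suc n × 1#)        ≈⟨ ⁻¹-∙-comm _ _ ⟨
    - (suc m × 1#) - suc n × 1#        ∎

  ⟦⟧-+* : ∀ m j → ⟦ + m ℤ.* j ⟧ℤ ≈ m × 1# * ⟦ j ⟧ℤ
  ⟦⟧-+* m (+ n)    = begin
    ⟦ + m ℤ.* + n ⟧ℤ                   ≡⟨ ≡.cong ⟦_⟧ℤ (ℤ.pos-* m n) ⟨
    (m ℕ.* n) × 1#                     ≈⟨ ×1-homo-* m n ⟩
    (m × 1#) * (n × 1#)                ∎
  ⟦⟧-+* m -[1+ n ] = begin
    ⟦ + m ℤ.* -[1+ n ] ⟧ℤ              ≡⟨ ≡.cong ⟦_⟧ℤ (ℤ.neg-distribʳ-* (+ m) (+ suc n)) ⟨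
    ⟦ ℤ.- (+ m ℤ.* + suc n) ⟧ℤ         ≈⟨ ⟦⟧-neg (+ m ℤ.* + suc n) ⟩
    - ⟦ + m ℤ.* + suc n ⟧ℤ             ≈⟨ -‿cong (⟦⟧-+* m (+ suc n)) ⟩
    - ((m × 1#) * (suc n × 1#))        ≈⟨ -‿distribʳ-* _ _ ⟩
    (m × 1#) * - (suc n × 1#)          ∎

  ⟦⟧-* : ∀ i j → ⟦ i ℤ.* j ⟧ℤ ≈ ⟦ i ⟧ℤ * ⟦ j ⟧ℤ
  ⟦⟧-* (+ m)    j = ⟦⟧-+* m j
  ⟦⟧-* -[1+ m ] j = begin
    ⟦ -[1+ m ] ℤ.* j ⟧ℤ                ≡⟨ ≡.cong ⟦_⟧ℤ (ℤ.neg-distribˡ-* (+ suc m) j) ⟨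
    ⟦ ℤ.- (+ suc m ℤ.* j) ⟧ℤ           ≈⟨ ⟦⟧-neg (+ suc m ℤ.* j) ⟩
    - ⟦ + suc m ℤ.* j ⟧ℤ               ≈⟨ -‿cong (⟦⟧-+* (suc m) j) ⟩
    - ((suc m × 1#) * ⟦ j ⟧ℤ)          ≈⟨ -‿distribˡ-* _ _ ⟩
    - (suc m × 1#) * ⟦ j ⟧ℤ            ∎

  morphism : ℤ.+-*-rawRing -Raw-AlmostCommutative⟶ fromCommutativeRing R
  morphism = record
    { ⟦_⟧    = ⟦_⟧ℤ
    ; +-homo = ⟦⟧-+
    ; *-homo = ⟦⟧-*
    ; -‿homo = ⟦⟧-neg
    ; 0-homo = refl
    ; 1-homo = refl
    }

  coefficient≟ : ∀ i j → Maybe (⟦ i ⟧ℤ ≈ ⟦ j ⟧ℤ)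
  coefficient≟ i j = mapMaybe (λ i≡j → reflexive (≡.cong ⟦_⟧ℤ i≡j)) (dec⇒weaklyDec ℤ._≟_ i j)

  open RingSolver ℤ.+-*-rawRing (fromCommutativeRing R) morphism coefficient≟ public
    using (solve; _:=_; _:+_; _:*_; _:-_; :-_; _:^_; con)

-- Order and apartness in a constructive real field

module RealFieldProperties {c ℓ₁ ℓ₂} (ℝ : RealField c ℓ₁ ℓ₂) where
  open RealField ℝ
  open CommutativeRing commutativeRing using (semiring)
  open HeytingProperties heytingCommutativeRing using (x-0≈x; invertibleˡ⇒#; #-congʳ)
  open IntegerSolver commutativeRing
  open SemiringExp semiring using (^-congˡ) public
  open SetoidReasoning setoid

  <⇒≤ : ∀ {x y} → x < y → x ≤ y
  <⇒≤ x<y y<x = <-asym x<y y<x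

  ≤-reflexive : ∀ {x y} → x ≈ y → x ≤ y
  ≤-reflexive x≈y y<x = <-irrefl (sym x≈y) y<x

  ≤-refl : ∀ {x} → x ≤ x
  ≤-refl = ≤-reflexive refl

  <-cotrans : ∀ {x y} → x < y → ∀ z → x < z ⊎ z < y
  <-cotrans x<y z with #-cotrans (<⇒# x<y) z
  ... | inj₁ x#z with #⇒<⊎> x#z
  ...   | inj₁ x<z = inj₁ x<z
  ...   | inj₂ z<x = inj₂ (<-trans z<x x<y)
  <-cotrans x<y z | inj₂ z#y with #⇒<⊎> z#y
  ...   | inj₁ z<y = inj₂ z<y
  ...   | inj₂ y<z = inj₁ (<-trans x<y y<z)

  ≤-<-trans : ∀ {x y z} → x ≤ y → y < z → x < z
  ≤-<-trans {x} x≤y y<z with <-cotrans y<z x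
  ... | inj₁ y<x = contradiction y<x x≤y
  ... | inj₂ x<z = x<z

  <-≤-trans : ∀ {x y z} → x < y → y ≤ z → x < z
  <-≤-trans {z = z} x<y y≤z with <-cotrans x<y z
  ... | inj₁ x<z = x<z
  ... | inj₂ z<y = contradiction z<y y≤z

  ≤-trans : ∀ {x y z} → x ≤ y → y ≤ z → x ≤ z
  ≤-trans x≤y y≤z z<x = y≤z (<-≤-trans z<x x≤y)

  ≤-respˡ-≈ : ∀ {x y z} → x ≈ y → x ≤ z → y ≤ z
  ≤-respˡ-≈ x≈y = ≤-trans (≤-reflexive (sym x≈y))

  ≤-respʳ-≈ : ∀ {x y z} → x ≈ y → z ≤ x → z ≤ y
  ≤-respʳ-≈ x≈y z≤x = ≤-trans z≤x (≤-reflexive x≈y)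

  x+z-z≈x : ∀ x z → (x + z) - z ≈ x
  x+z-z≈x = solve 2 (λ x z → (x :+ z) :- z := x) refl

  x-y+y≈x : ∀ x y → (x - y) + y ≈ x
  x-y+y≈x = solve 2 (λ x y → (x :- y) :+ y := x) refl

  x<y⇒0<y-x : ∀ {x y} → x < y → 0# < y - x
  x<y⇒0<y-x {x} x<y = <-respˡ-≈ (-‿inverseʳ x) (+-monoˡ-< (- x) x<y)

  0<y-x⇒x<y : ∀ {x y} → 0# < y - x → x < y
  0<y-x⇒x<y {x} {y} 0<y-x =
    <-respˡ-≈ (+-identityˡ x) (<-respʳ-≈ (x-y+y≈x y x) (+-monoˡ-< x 0<y-x))

  +-monoˡ-≤ : ∀ {x y} z → x ≤ y → x + z ≤ y + z
  +-monoˡ-≤ z x≤y y+z<x+z =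
    x≤y (<-respˡ-≈ (x+z-z≈x _ z) (<-respʳ-≈ (x+z-z≈x _ z) (+-monoˡ-< (- z) y+z<x+z)))

  +-mono-≤ : ∀ {x y u v} → x ≤ y → u ≤ v → x + u ≤ y + v
  +-mono-≤ {x} {y} {u} {v} x≤y u≤v = ≤-trans (+-monoˡ-≤ u x≤y)
    (≤-respˡ-≈ (+-comm u y) (≤-respʳ-≈ (+-comm v y) (+-monoˡ-≤ y u≤v)))

  +-nonneg : ∀ {x y} → 0# ≤ x → 0# ≤ y → 0# ≤ x + y
  +-nonneg 0≤x 0≤y = ≤-respˡ-≈ (+-identityˡ 0#) (+-mono-≤ 0≤x 0≤y)

  x≤y⇒0≤y-x : ∀ {x y} → x ≤ y → 0# ≤ y - x
  x≤y⇒0≤y-x {x} x≤y = ≤-respˡ-≈ (-‿inverseʳ x) (+-monoˡ-≤ (- x) x≤y)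

  0≤y-x⇒x≤y : ∀ {x y} → 0# ≤ y - x → x ≤ y
  0≤y-x⇒x≤y {x} {y} 0≤y-x =
    ≤-respˡ-≈ (+-identityˡ x) (≤-respʳ-≈ (x-y+y≈x y x) (+-monoˡ-≤ x 0≤y-x))

  -- If `w` inverts `x * y`, then `w * x` inverts `y`, and invertible elements are apart from zero.
  xy#0⇒y#0 : ∀ {x y} → x * y # 0# → y # 0#
  xy#0⇒y#0 {x} {y} xy#0 with #⇒invertible xy#0
  ... | w , w[xy-0]≈1 , _ = invertibleˡ⇒# (w * x , (begin
    w * x * (y - 0#)       ≈⟨ *-congˡ (x-0≈x y) ⟩
    w * x * y              ≈⟨ *-assoc w x y ⟩
    w * (x * y)            ≈⟨ *-congˡ (x-0≈x (x * y)) ⟨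
    w * (x * y - 0#)       ≈⟨ w[xy-0]≈1 ⟩
    1#                     ∎))

  x#0∧xy≈0⇒y≈0 : ∀ {x y} → x # 0# → x * y ≈ 0# → y ≈ 0#
  x#0∧xy≈0⇒y≈0 {x} {y} x#0 xy≈0 with #⇒invertible x#0
  ... | w , w[x-0]≈1 , _ = begin
    y                  ≈⟨ *-identityˡ y ⟨
    1# * y             ≈⟨ *-congʳ w[x-0]≈1 ⟨
    w * (x - 0#) * y   ≈⟨ *-congʳ (*-congˡ (x-0≈x x)) ⟩
    w * x * y          ≈⟨ *-assoc w x y ⟩
    w * (x * y)        ≈⟨ *-congˡ xy≈0 ⟩
    w * 0#             ≈⟨ zeroʳ w ⟩
    0#                 ∎

  -- By tightness it is enough to refute `y # 0#`, which would force `x ≈ 0#`. A negated equality is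
  -- all that nontriviality of the character supplies, so the version with `x # 0#` does not apply
  -- there.
  x≉0∧xy≈0⇒y≈0 : ∀ {x y} → ¬ (x ≈ 0#) → x * y ≈ 0# → y ≈ 0#
  x≉0∧xy≈0⇒y≈0 {x} {y} x≉0 xy≈0 = proj₁ (tight y 0#) λ y#0 →
    x≉0 (x#0∧xy≈0⇒y≈0 y#0 (trans (*-comm y x) xy≈0))

  0≤x∧x#0⇒0<x : ∀ {x} → 0# ≤ x → x # 0# → 0# < x
  0≤x∧x#0⇒0<x 0≤x x#0 with #⇒<⊎> x#0
  ... | inj₁ x<0 = contradiction x<0 0≤x
  ... | inj₂ 0<x = 0<x

  -- A strictly negative product is apart from zero, hence so are both factors; being nonnegative
  -- they are then positive, and so is the product. No case split on a vanishing factor occurs.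
  *-nonneg : ∀ {x y} → 0# ≤ x → 0# ≤ y → 0# ≤ x * y
  *-nonneg {x} {y} 0≤x 0≤y xy<0 = <-asym xy<0 (*-positive
    (0≤x∧x#0⇒0<x 0≤x (xy#0⇒y#0 (#-congʳ (*-comm x y) xy#0)))
    (0≤x∧x#0⇒0<x 0≤y (xy#0⇒y#0 xy#0)))
    where
    xy#0 = <⇒# xy<0

  x#0⇒0<x*x : ∀ {x} → x # 0# → 0# < x * x
  x#0⇒0<x*x {x} x#0 with #⇒<⊎> x#0
  ... | inj₂ 0<x = *-positive 0<x 0<x
  ... | inj₁ x<0 = <-respʳ-≈ (solve 1 (λ x → (con (+ 0) :- x) :* (con (+ 0) :- x) := x :* x) refl x)
                     (*-positive (x<y⇒0<y-x x<0) (x<y⇒0<y-x x<0))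

  0≤x*x : ∀ x → 0# ≤ x * x
  0≤x*x x xx<0 = <-asym xx<0 (x#0⇒0<x*x (xy#0⇒y#0 (<⇒# xx<0)))

  x*x+y*y≈0⇒x≈0 : ∀ {x y} → x * x + y * y ≈ 0# → x ≈ 0#
  x*x+y*y≈0⇒x≈0 {x} {y} eq = proj₁ (tight x 0#) λ x#0 →
    <-irrefl (sym eq) (≤-<-trans (0≤x*x y)
      (<-respˡ-≈ (+-identityˡ (y * y)) (+-monoˡ-< (y * y) (x#0⇒0<x*x x#0))))

  *-monoˡ-≤ : ∀ {x y z} → 0# ≤ z → x ≤ y → x * z ≤ y * z
  *-monoˡ-≤ {x} {y} {z} 0≤z x≤y = 0≤y-x⇒x≤y (≤-respʳ-≈
    (solve 3 (λ x y z → (y :- x) :* z := y :* z :- x :* z) refl x y z)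
    (*-nonneg (x≤y⇒0≤y-x x≤y) 0≤z))

  *-mono-≤ : ∀ {x y u v} → 0# ≤ y → 0# ≤ u → x ≤ y → u ≤ v → x * u ≤ y * v
  *-mono-≤ {x} {y} {u} {v} 0≤y 0≤u x≤y u≤v = ≤-trans (*-monoˡ-≤ 0≤u x≤y)
    (≤-respˡ-≈ (*-comm u y) (≤-respʳ-≈ (*-comm v y) (*-monoˡ-≤ 0≤y u≤v)))

  *-monoˡ-< : ∀ {x y z} → 0# < z → x < y → x * z < y * z
  *-monoˡ-< {x} {y} {z} 0<z x<y = 0<y-x⇒x<y (<-respʳ-≈
    (solve 3 (λ x y z → (y :- x) :* z := y :* z :- x :* z) refl x y z)
    (*-positive (x<y⇒0<y-x x<y) 0<z))

  *-cancelʳ-≤ : ∀ {x y z} → 0# < z → x * z ≤ y * z → x ≤ y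
  *-cancelʳ-≤ 0<z xz≤yz y<x = xz≤yz (*-monoˡ-< 0<z y<x)

  ^-nonneg : ∀ {x} n → 0# ≤ x → 0# ≤ x ^ n
  ^-nonneg zero    0≤x = <⇒≤ 0<1
  ^-nonneg (suc n) 0≤x = *-nonneg 0≤x (^-nonneg n 0≤x)

  ^-mono-≤ : ∀ {x y} n → 0# ≤ x → x ≤ y → x ^ n ≤ y ^ n
  ^-mono-≤ zero    0≤x x≤y = ≤-refl
  ^-mono-≤ (suc n) 0≤x x≤y =
    *-mono-≤ (≤-trans 0≤x x≤y) (^-nonneg n 0≤x) x≤y (^-mono-≤ n 0≤x x≤y)

  ^-positive : ∀ {x} n → 0# < x → 0# < x ^ n
  ^-positive zero    0<x = 0<1
  ^-positive (suc n) 0<x = *-positive 0<x (^-positive n 0<x)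

  ^-mono-< : ∀ {x y} n .{{_ : ℕ.NonZero n}} → 0# ≤ x → x < y → x ^ n < y ^ n
  ^-mono-< {x} {y} (suc n) 0≤x x<y = ≤-<-trans
    (*-mono-≤ 0≤x (^-nonneg n 0≤x) ≤-refl (^-mono-≤ n 0≤x (<⇒≤ x<y)))
    (*-monoˡ-< (^-positive n (≤-<-trans 0≤x x<y)) x<y)

  -- Strict growth of powers, read contrapositively. It closes the main estimate, which is carried
  -- out for fourth powers.
  ^-cancel-≤ : ∀ {x y} n .{{_ : ℕ.NonZero n}} → 0# ≤ y → x ^ n ≤ y ^ n → x ≤ y
  ^-cancel-≤ n 0≤y xⁿ≤yⁿ y<x = xⁿ≤yⁿ (^-mono-< n 0≤y y<x)

  0≤fromℕ : ∀ n → 0# ≤ fromℕ n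
  0≤fromℕ zero    = ≤-refl
  0≤fromℕ (suc n) = <⇒≤ (0<fromℕ (suc n))

  fromℕ-mono-≤ : ∀ {m n} → m ℕ.≤ n → fromℕ m ≤ fromℕ n
  fromℕ-mono-≤ {n = n} z≤n   = 0≤fromℕ n
  fromℕ-mono-≤ (s≤s m≤n) = +-mono-≤ ≤-refl (fromℕ-mono-≤ m≤n)

-- Finite sums, Cauchy-Schwarz and indicators

module FiniteSums {c ℓ₁ ℓ₂} (ℝ : RealField c ℓ₁ ℓ₂) where
  open RealField ℝ
  open RealFieldProperties ℝ
  open IntegerSolver commutativeRing
  open SetoidReasoning setoid

  infixr 5 ∑

  -- Unfolds to the same `foldr` as the sum inside `fourierNorm₄`, which is therefore a `∑` by
  -- definition.
  ∑ : ∀ {a} {A : Set a} → List A → (A → Carrier) → Carrier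
  ∑ xs f = foldr (λ x r → f x + r) 0# xs

  syntax ∑ xs (λ x → e) = ∑[ x ∈ xs ] e

  module _ {a} {A : Set a} where

    ∑-congAll : ∀ {f g : A → Carrier} {xs} → All (λ x → f x ≈ g x) xs → ∑ xs f ≈ ∑ xs g
    ∑-congAll []         = refl
    ∑-congAll (eq ∷ eqs) = +-cong eq (∑-congAll eqs)

    ∑-cong : ∀ {f g : A → Carrier} xs → (∀ x → f x ≈ g x) → ∑ xs f ≈ ∑ xs g
    ∑-cong xs f≈g = ∑-congAll (All.universal f≈g xs)

    ∑-zeroAll : ∀ {f : A → Carrier} {xs} → All (λ x → f x ≈ 0#) xs → ∑ xs f ≈ 0#
    ∑-zeroAll []         = refl
    ∑-zeroAll (eq ∷ eqs) = trans (+-cong eq (∑-zeroAll eqs)) (+-identityˡ 0#)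

    ∑-monoAll : ∀ {f g : A → Carrier} {xs} → All (λ x → f x ≤ g x) xs → ∑ xs f ≤ ∑ xs g
    ∑-monoAll []         = ≤-refl
    ∑-monoAll (le ∷ les) = +-mono-≤ le (∑-monoAll les)

    ∑-mono : ∀ {f g : A → Carrier} xs → (∀ x → f x ≤ g x) → ∑ xs f ≤ ∑ xs g
    ∑-mono xs f≤g = ∑-monoAll (All.universal f≤g xs)

    ∑-nonneg : ∀ {f : A → Carrier} xs → (∀ x → 0# ≤ f x) → 0# ≤ ∑ xs f
    ∑-nonneg []       0≤f = ≤-refl
    ∑-nonneg (x ∷ xs) 0≤f = +-nonneg (0≤f x) (∑-nonneg xs 0≤f)

    ∑-+ : ∀ (f g : A → Carrier) xs → (∑[ x ∈ xs ] f x + g x) ≈ ∑ xs f + ∑ xs g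
    ∑-+ f g []       = sym (+-identityˡ 0#)
    ∑-+ f g (x ∷ xs) = trans (+-congˡ (∑-+ f g xs))
      (solve 4 (λ a b p q → a :+ b :+ (p :+ q) := a :+ p :+ (b :+ q)) refl
        (f x) (g x) (∑ xs f) (∑ xs g))

    ∑-*ˡ : ∀ z (f : A → Carrier) xs → (∑[ x ∈ xs ] z * f x) ≈ z * ∑ xs f
    ∑-*ˡ z f []       = sym (zeroʳ z)
    ∑-*ˡ z f (x ∷ xs) = trans (+-congˡ (∑-*ˡ z f xs)) (sym (distribˡ z _ _))

    ∑-*ʳ : ∀ z (f : A → Carrier) xs → (∑[ x ∈ xs ] f x * z) ≈ ∑ xs f * z
    ∑-*ʳ z f xs = trans (∑-cong xs (λ x → *-comm (f x) z)) (trans (∑-*ˡ z f xs) (*-comm z _))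

    ∑-const : ∀ z (xs : List A) → (∑[ x ∈ xs ] z) ≈ fromℕ (length xs) * z
    ∑-const z []       = sym (zeroˡ z)
    ∑-const z (x ∷ xs) = trans (+-congˡ (∑-const z xs))
      (solve 2 (λ z n → z :+ n :* z := (con (+ 1) :+ n) :* z) refl z (fromℕ (length xs)))

    ∑-++ : ∀ (f : A → Carrier) xs ys → ∑ (xs ++ ys) f ≈ ∑ xs f + ∑ ys f
    ∑-++ f []       ys = sym (+-identityˡ _)
    ∑-++ f (x ∷ xs) ys = trans (+-congˡ (∑-++ f xs ys)) (sym (+-assoc _ _ _))

  ∑-map : ∀ {a b} {A : Set a} {B : Set b} (f : B → Carrier) (g : A → B) xs →
          ∑ (List.map g xs) f ≡ (∑[ x ∈ xs ] f (g x))
  ∑-map f g []       = ≡.refl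
  ∑-map f g (x ∷ xs) = ≡.cong (λ r → f (g x) + r) (∑-map f g xs)

  module _ {a b} {A : Set a} {B : Set b} where

    ∑-swap : ∀ (f : A → B → Carrier) xs ys →
             (∑[ x ∈ xs ] ∑[ y ∈ ys ] f x y) ≈ (∑[ y ∈ ys ] ∑[ x ∈ xs ] f x y)
    ∑-swap f []       ys = sym (∑-zeroAll {xs = ys} (All.universal (λ _ → refl) ys))
    ∑-swap f (x ∷ xs) ys = trans (+-congˡ (∑-swap f xs ys)) (sym (∑-+ (f x) _ ys))

    ∑-cartesianProduct : ∀ (f : A Product.× B → Carrier) xs ys →
                         ∑ (cartesianProduct xs ys) f ≈ (∑[ x ∈ xs ] ∑[ y ∈ ys ] f (x , y))
    ∑-cartesianProduct f []       ys = refl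
    ∑-cartesianProduct f (x ∷ xs) ys = trans (∑-++ f (List.map (x ,_) ys) _)
      (+-cong (reflexive (∑-map f (x ,_) ys)) (∑-cartesianProduct f xs ys))

  -- The sum of (b fᵢ − a gᵢ)² is the defect gained when the terms a and b are
  -- prepended to f and g.
  cauchySchwarz : ∀ {a} {A : Set a} (f g : A → Carrier) xs →
    (∑[ x ∈ xs ] f x * g x) * (∑[ x ∈ xs ] f x * g x)
      ≤ (∑[ x ∈ xs ] f x * f x) * (∑[ x ∈ xs ] g x * g x)
  cauchySchwarz f g []       = ≤-refl
  cauchySchwarz f g (x ∷ xs) = 0≤y-x⇒x≤y (≤-respʳ-≈
    (solve 5 (λ a b p F G →
        (F :* G :- p :* p) :+ (b :* b :* F :+ a :* a :* G :- con (+ 2) :* (a :* b :* p))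
          := (a :* a :+ F) :* (b :* b :+ G) :- (a :* b :+ p) :* (a :* b :+ p))
      refl (f x) (g x) _ _ _)
    (+-nonneg (x≤y⇒0≤y-x (cauchySchwarz f g xs))
      (≤-respʳ-≈ (defect (f x) (g x) xs) (∑-nonneg xs (λ _ → 0≤x*x _)))))
    where
    defect : ∀ a b xs →
      (∑[ x ∈ xs ] (b * f x - a * g x) * (b * f x - a * g x))
        ≈ b * b * (∑[ x ∈ xs ] f x * f x) + a * a * (∑[ x ∈ xs ] g x * g x)
          - ⟦ + 2 ⟧ℤ * (a * b * (∑[ x ∈ xs ] f x * g x))
    defect a b []       = solve 2 (λ a b → con (+ 0) :=
      b :* b :* con (+ 0) :+ a :* a :* con (+ 0) :- con (+ 2) :* (a :* b :* con (+ 0))) refl a b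
    defect a b (x ∷ xs) = trans (+-congˡ (defect a b xs))
      (solve 7 (λ a b u v F G p →
        (b :* u :- a :* v) :* (b :* u :- a :* v)
          :+ (b :* b :* F :+ a :* a :* G :- con (+ 2) :* (a :* b :* p))
          := b :* b :* (u :* u :+ F) :+ a :* a :* (v :* v :+ G)
             :- con (+ 2) :* (a :* b :* (u :* v :+ p)))
        refl a b (f x) (g x) _ _ _)

  -- The complex inequality in real form: the doubled index list carries real parts on its left half
  -- and imaginary parts on its right half, so the scalar inequality applies as it is.
  cauchySchwarz₂ : ∀ {a} {A : Set a} (f f′ g g′ : A → Carrier) xs →
    (∑[ x ∈ xs ] f x * g x + f′ x * g′ x) * (∑[ x ∈ xs ] f x * g x + f′ x * g′ x)
      ≤ (∑[ x ∈ xs ] f x * f x + f′ x * f′ x) * (∑[ x ∈ xs ] g x * g x + g′ x * g′ x)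
  cauchySchwarz₂ {A = A} f f′ g g′ xs = ≤-respˡ-≈ (*-cong (split u v) (split u v))
    (≤-respʳ-≈ (*-cong (split u u) (split v v)) (cauchySchwarz u v xs⊎xs))
    where
    u = Sum.[ f , f′ ]
    v = Sum.[ g , g′ ]
    xs⊎xs = List.map inj₁ xs ++ List.map inj₂ xs

    split : ∀ (k l : A ⊎ A → Carrier) →
      (∑[ z ∈ xs⊎xs ] k z * l z)
        ≈ (∑[ x ∈ xs ] k (inj₁ x) * l (inj₁ x) + k (inj₂ x) * l (inj₂ x))
    split k l = trans (∑-++ _ (List.map inj₁ xs) _) (trans
      (+-cong (reflexive (∑-map _ inj₁ xs)) (reflexive (∑-map _ inj₂ xs)))
      (sym (∑-+ _ _ xs)))

  𝟙 : ∀ {p} {P : Set p} → Dec P → Carrier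
  𝟙 (yes _) = 1#
  𝟙 (no  _) = 0#

  module _ {p} {P : Set p} where

    𝟙-yes : ∀ (P? : Dec P) → P → 𝟙 P? ≈ 1#
    𝟙-yes (yes _) _ = refl
    𝟙-yes (no ¬p) p = contradiction p ¬p

    𝟙-no : ∀ (P? : Dec P) → ¬ P → 𝟙 P? ≈ 0#
    𝟙-no (yes p) ¬p = contradiction p ¬p
    𝟙-no (no _)  _  = refl

    0≤𝟙 : ∀ (P? : Dec P) → 0# ≤ 𝟙 P?
    0≤𝟙 (yes _) = <⇒≤ 0<1
    0≤𝟙 (no _)  = ≤-refl

    𝟙*≤ : ∀ (P? : Dec P) {x} → 0# ≤ x → 𝟙 P? * x ≤ x
    𝟙*≤ (yes _) 0≤x = ≤-reflexive (*-identityˡ _)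
    𝟙*≤ (no _)  0≤x = ≤-respˡ-≈ (sym (zeroˡ _)) 0≤x

    𝟙-idem : ∀ (P? : Dec P) → 𝟙 P? * 𝟙 P? ≈ 𝟙 P?
    𝟙-idem (yes _) = *-identityˡ 1#
    𝟙-idem (no _)  = zeroˡ 0#

  𝟙-cong : ∀ {p q} {P : Set p} {Q : Set q} (P? : Dec P) (Q? : Dec Q) →
           (P → Q) → (Q → P) → 𝟙 P? ≈ 𝟙 Q?
  𝟙-cong (yes p) Q? P⇒Q Q⇒P = sym (𝟙-yes Q? (P⇒Q p))
  𝟙-cong (no ¬p) Q? P⇒Q Q⇒P = sym (𝟙-no Q? λ q → ¬p (Q⇒P q))

  ∑-filter : ∀ {a p} {A : Set a} {P : Pred A p} (P? : Decidable P) (f : A → Carrier) xs →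
    ∑ (filter P? xs) f ≈ (∑[ x ∈ xs ] 𝟙 (P? x) * f x)
  ∑-filter P? f []       = refl
  ∑-filter P? f (x ∷ xs) with P? x
  ... | yes _ = +-cong (sym (*-identityˡ _)) (∑-filter P? f xs)
  ... | no  _ = trans (∑-filter P? f xs) (trans (sym (+-identityˡ _)) (+-congʳ (sym (zeroˡ _))))

  fromℕ-length : ∀ {a} {A : Set a} (xs : List A) → fromℕ (length xs) ≈ (∑[ x ∈ xs ] 1#)
  fromℕ-length xs = sym (trans (∑-const 1# xs) (*-identityʳ _))

  fromℕ-length-filter : ∀ {a p} {A : Set a} {P : Pred A p} (P? : Decidable P) xs →
    fromℕ (length (filter P? xs)) ≈ (∑[ x ∈ xs ] 𝟙 (P? x))
  fromℕ-length-filter P? xs = trans (fromℕ-length (filter P? xs))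
    (trans (∑-filter P? _ xs) (∑-cong xs λ x → *-identityʳ _))

-- Kronecker deltas and weights pushed forward along a map

module KroneckerSums {c ℓ₁ ℓ₂ a ℓ} (ℝ : RealField c ℓ₁ ℓ₂) (D : DecSetoid a ℓ) where
  open RealField ℝ
  open RealFieldProperties ℝ
  open FiniteSums ℝ
  open IntegerSolver commutativeRing
  open SetoidReasoning setoid
  private module D = DecSetoid D
  open Membership D.setoid using (_∈_)
  open Unique D.setoid using (Unique)

  Respectful : (D.Carrier → Carrier) → Set _
  Respectful f = ∀ {x y} → x D.≈ y → f x ≈ f y

  -- In a list without repetitions exactly one entry matches `z`. It matches only up to setoid
  -- equality, whence the condition on `f`.
  ∑-δ* : ∀ {f} → Respectful f → ∀ {xs z} → Unique xs → z ∈ xs →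
         (∑[ x ∈ xs ] 𝟙 (x D.≟ z) * f x) ≈ f z
  ∑-δ* {f} f-resp {x ∷ xs} {z} (x≉xs ∷ xs!) (here z≈x) = begin
    𝟙 (x D.≟ z) * f x + (∑[ y ∈ xs ] 𝟙 (y D.≟ z) * f y)
      ≈⟨ +-cong (*-cong (𝟙-yes (x D.≟ z) (D.sym z≈x)) (f-resp (D.sym z≈x)))
                (∑-zeroAll (All.map (λ {y} x≉y → trans
                  (*-congʳ (𝟙-no (y D.≟ z) λ y≈z → x≉y (D.sym (D.trans y≈z z≈x)))) (zeroˡ _)) x≉xs)) ⟩
    1# * f z + 0#  ≈⟨ +-identityʳ _ ⟩
    1# * f z       ≈⟨ *-identityˡ _ ⟩
    f z            ∎
  ∑-δ* {f} f-resp {x ∷ xs} {z} (x≉xs ∷ xs!) (there z∈xs) = begin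
    𝟙 (x D.≟ z) * f x + (∑[ y ∈ xs ] 𝟙 (y D.≟ z) * f y)
      ≈⟨ +-cong (*-congʳ (𝟙-no (x D.≟ z) λ x≈z →
           All.All¬⇒¬Any x≉xs (Any.map (D.trans x≈z) z∈xs))) (∑-δ* f-resp xs! z∈xs) ⟩
    0# * f x + f z  ≈⟨ +-congʳ (zeroˡ _) ⟩
    0# + f z        ≈⟨ +-identityˡ _ ⟩
    f z             ∎

  ∑-δ : ∀ {xs z} → Unique xs → z ∈ xs → (∑[ x ∈ xs ] 𝟙 (x D.≟ z)) ≈ 1#
  ∑-δ {xs} xs! z∈xs =
    trans (∑-cong xs (λ x → sym (*-identityʳ _))) (∑-δ* (λ _ → refl) xs! z∈xs)

  module _ {j} {J : Set j} (js : List J) (w : J → D.Carrier) where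

    -- The total weight lying over `x`. With `dilate` for `w` and the real and imaginary parts of
    -- the phases for `α`, this gives the two parts of the weight G, up to conjugation.
    pushforward : (J → Carrier) → D.Carrier → Carrier
    pushforward α x = ∑[ j ∈ js ] 𝟙 (x D.≟ w j) * α j

    pushforward-resp : ∀ α → Respectful (pushforward α)
    pushforward-resp α {x} {y} x≈y = ∑-cong js λ j → *-congʳ
      (𝟙-cong (x D.≟ w j) (y D.≟ w j) (D.trans (D.sym x≈y)) (D.trans x≈y))

    inImage? : ∀ x → Dec (Any (λ j → x D.≈ w j) js)
    inImage? x = Any.any? (λ j → x D.≟ w j) js

    -- The inserted indicator survives Cauchy-Schwarz and restricts the other factor to the image of
    -- `w`; without it the size of the whole space would enter.
    pushforward-support : ∀ α x → pushforward α x ≈ pushforward α x * 𝟙 (inImage? x)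
    pushforward-support α x with inImage? x
    ... | yes _  = sym (*-identityʳ _)
    ... | no ¬im = trans
      (∑-zeroAll (All.map (λ {j} x≉wj → trans (*-congʳ (𝟙-no (x D.≟ w j) x≉wj)) (zeroˡ _))
        (All.¬Any⇒All¬ js ¬im)))
      (sym (zeroʳ _))

    𝟙-inImage≤ : ∀ x → 𝟙 (inImage? x) ≤ (∑[ j ∈ js ] 𝟙 (x D.≟ w j))
    𝟙-inImage≤ x with inImage? x
    ... | no _   = ∑-nonneg js (λ j → 0≤𝟙 (x D.≟ w j))
    ... | yes im = 1≤ im
      where
      1≤ : ∀ {ks} → Any (λ j → x D.≈ w j) ks → 1# ≤ (∑[ j ∈ ks ] 𝟙 (x D.≟ w j))
      1≤ {j ∷ ks} (here x≈wj) = ≤-respˡ-≈ (+-identityʳ 1#) (+-mono-≤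
        (≤-reflexive (sym (𝟙-yes (x D.≟ w j) x≈wj))) (∑-nonneg ks (λ k → 0≤𝟙 (x D.≟ w k))))
      1≤ {j ∷ ks} (there im) = ≤-respˡ-≈ (+-identityˡ 1#) (+-mono-≤ (0≤𝟙 (x D.≟ w j)) (1≤ im))

    -- The squared L² norm of the pushforward of α + iβ, expanded over pairs of indices with the
    -- same image. This form mentions no list of points, so it can be estimated from the indices
    -- alone.
    collisions : (α β : J → Carrier) → Carrier
    collisions α β = ∑[ j ∈ js ] ∑[ k ∈ js ] 𝟙 (w j D.≟ w k) * (α j * α k + β j * β k)

    module _ {xs} (xs! : Unique xs) (w∈xs : All (λ j → w j ∈ xs) js) where

      -- Once the sums are exchanged, each `j` meets a delta at `w j`. Taking a pushforward for `f`
      -- produces the double sums of `collisions`.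
      ∑-pushforward : ∀ α {f} → Respectful f →
        (∑[ x ∈ xs ] pushforward α x * f x) ≈ (∑[ j ∈ js ] α j * f (w j))
      ∑-pushforward α {f} f-resp = begin
        (∑[ x ∈ xs ] pushforward α x * f x)
          ≈⟨ ∑-cong xs (λ x → trans (sym (∑-*ʳ (f x) _ js)) (∑-cong js λ j →
               solve 3 (λ e a b → e :* a :* b := a :* (e :* b)) refl _ (α j) (f x))) ⟩
        (∑[ x ∈ xs ] ∑[ j ∈ js ] α j * (𝟙 (x D.≟ w j) * f x))
          ≈⟨ ∑-swap _ xs js ⟩
        (∑[ j ∈ js ] ∑[ x ∈ xs ] α j * (𝟙 (x D.≟ w j) * f x))
          ≈⟨ ∑-congAll (All.map (λ {j} wj∈xs →
               trans (∑-*ˡ (α j) _ xs) (*-congˡ (∑-δ* f-resp xs! wj∈xs))) w∈xs) ⟩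
        (∑[ j ∈ js ] α j * f (w j)) ∎

      ∑-inImage≤ : (∑[ x ∈ xs ] 𝟙 (inImage? x)) ≤ fromℕ (length js)
      ∑-inImage≤ = ≤-trans (∑-mono xs 𝟙-inImage≤) (≤-reflexive (begin
        (∑[ x ∈ xs ] ∑[ j ∈ js ] 𝟙 (x D.≟ w j)) ≈⟨ ∑-swap _ xs js ⟩
        (∑[ j ∈ js ] ∑[ x ∈ xs ] 𝟙 (x D.≟ w j)) ≈⟨ ∑-congAll (All.map (∑-δ xs!) w∈xs) ⟩
        (∑[ j ∈ js ] 1#)                        ≈⟨ ∑-const 1# js ⟩
        fromℕ (length js) * 1#                  ≈⟨ *-identityʳ _ ⟩
        fromℕ (length js)                       ∎))

      module _ (α β : J → Carrier) {A B : D.Carrier → Carrier}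
               (A-resp : Respectful A) (B-resp : Respectful B) where

        -- Two applications of Cauchy–Schwarz stand in for Hölder's inequality with
        -- exponents 4/3 and 4, the support of the pushforward having at most
        -- length js elements.
        fourthMoment-≤ : ∀ {ρ} → collisions α β ≤ ρ →
          (∑[ j ∈ js ] α j * A (w j) + β j * B (w j)) ^ 4
            ≤ ρ * ρ *
              (fromℕ (length js) *
               (∑[ x ∈ xs ] (A x * A x + B x * B x) * (A x * A x + B x * B x)))
        fourthMoment-≤ {ρ} R≤ρ = ≤-respˡ-≈ (solve 1 (λ e → (e :* e) :* (e :* e) := e :^ 4) refl E)
          (≤-trans (*-mono-≤ (*-nonneg 0≤ρ 0≤N) (0≤x*x E) E²≤ρN E²≤ρN)
          (≤-respˡ-≈ (solve 2 (λ r n → n :* n :* (r :* r) := r :* n :* (r :* n)) refl ρ N)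
          (≤-respʳ-≈ (*-comm _ (ρ * ρ)) (*-monoˡ-≤ (0≤x*x ρ) N²≤))))
          where
          E R N : Carrier
          n I : D.Carrier → Carrier
          E = ∑[ j ∈ js ] α j * A (w j) + β j * B (w j)
          R = collisions α β
          I x = 𝟙 (inImage? x)
          n x = A x * A x + B x * B x
          N = ∑[ x ∈ xs ] I x * n x
          Gα = pushforward α
          Gβ = pushforward β

          0≤n : ∀ x → 0# ≤ n x
          0≤n x = +-nonneg (0≤x*x (A x)) (0≤x*x (B x))

          0≤N : 0# ≤ N
          0≤N = ∑-nonneg xs λ x → *-nonneg (0≤𝟙 (inImage? x)) (0≤n x)

          -- The indicator is attached to `A` and `B`, so that the factor split off by
          -- Cauchy-Schwarz is `N`, a sum over the image only.
          E≈ : E ≈ (∑[ x ∈ xs ] Gα x * (I x * A x) + Gβ x * (I x * B x))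
          E≈ = begin
            E ≈⟨ ∑-+ _ _ js ⟩
            (∑[ j ∈ js ] α j * A (w j)) + (∑[ j ∈ js ] β j * B (w j))
              ≈⟨ +-cong (∑-pushforward α A-resp) (∑-pushforward β B-resp) ⟨
            (∑[ x ∈ xs ] Gα x * A x) + (∑[ x ∈ xs ] Gβ x * B x)
              ≈⟨ ∑-+ _ _ xs ⟨
            (∑[ x ∈ xs ] Gα x * A x + Gβ x * B x)
              ≈⟨ ∑-cong xs (λ x → +-cong
                   (trans (*-congʳ (pushforward-support α x)) (*-assoc _ _ _))
                   (trans (*-congʳ (pushforward-support β x)) (*-assoc _ _ _))) ⟩
            (∑[ x ∈ xs ] Gα x * (I x * A x) + Gβ x * (I x * B x)) ∎

          expand : ∀ γ → (∑[ x ∈ xs ] pushforward γ x * pushforward γ x)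
            ≈ (∑[ j ∈ js ] ∑[ k ∈ js ] 𝟙 (w j D.≟ w k) * (γ j * γ k))
          expand γ = trans (∑-pushforward γ (pushforward-resp γ)) (∑-cong js λ j →
            trans (sym (∑-*ˡ (γ j) _ js)) (∑-cong js λ k →
              solve 3 (λ e a b → a :* (e :* b) := e :* (a :* b)) refl _ (γ j) (γ k)))

          R≈ : (∑[ x ∈ xs ] Gα x * Gα x + Gβ x * Gβ x) ≈ R
          R≈ = begin
            (∑[ x ∈ xs ] Gα x * Gα x + Gβ x * Gβ x) ≈⟨ ∑-+ _ _ xs ⟩
            (∑[ x ∈ xs ] Gα x * Gα x) + (∑[ x ∈ xs ] Gβ x * Gβ x)
              ≈⟨ +-cong (expand α) (expand β) ⟩
            _ ≈⟨ ∑-+ _ _ js ⟨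
            _ ≈⟨ ∑-cong js (λ j → trans (sym (∑-+ _ _ js)) (∑-cong js λ k → sym (distribˡ _ _ _))) ⟩
            R ∎

          0≤R : 0# ≤ R
          0≤R = ≤-respʳ-≈ R≈ (∑-nonneg xs λ x → +-nonneg (0≤x*x _) (0≤x*x _))

          0≤ρ : 0# ≤ ρ
          0≤ρ = ≤-trans 0≤R R≤ρ

          E²≤RN : E * E ≤ R * N
          E²≤RN = ≤-respˡ-≈ (*-cong (sym E≈) (sym E≈)) (≤-respʳ-≈ (*-cong R≈
            (∑-cong xs λ x → trans
              (solve 3 (λ i a b → i :* a :* (i :* a) :+ i :* b :* (i :* b)
                                    := i :* i :* (a :* a :+ b :* b)) refl (I x) (A x) (B x))
              (*-congʳ (𝟙-idem (inImage? x)))))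
            (cauchySchwarz₂ Gα Gβ (λ x → I x * A x) (λ x → I x * B x) xs))

          E²≤ρN : E * E ≤ ρ * N
          E²≤ρN = ≤-trans E²≤RN (*-monoˡ-≤ 0≤N R≤ρ)

          -- Here `n` is paired with the indicator of the image instead of with 1, so the price is
          -- the number of image points and not the length of `xs`.
          N²≤ : N * N ≤ fromℕ (length js) * (∑[ x ∈ xs ] n x * n x)
          N²≤ = ≤-trans (cauchySchwarz I n xs) (*-monoˡ-≤ (∑-nonneg xs λ x → 0≤x*x (n x))
            (≤-respˡ-≈ (∑-cong xs λ x → sym (𝟙-idem (inImage? x))) ∑-inImage≤))

  -- The constant weight 1 pushed forward along φ is again 1 at each listed `y`, since y = φ x holds
  -- for x = ψ y alone.
  ∑-reindex : ∀ {f} → Respectful f → ∀ {xs} → Unique xs → (φ ψ : D.Carrier → D.Carrier) →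
    (∀ {x y} → y D.≈ φ x → x D.≈ ψ y) → (∀ {x y} → x D.≈ ψ y → y D.≈ φ x) →
    All (λ x → φ x ∈ xs) xs → All (λ x → ψ x ∈ xs) xs →
    (∑[ x ∈ xs ] f (φ x)) ≈ ∑ xs f
  ∑-reindex {f} f-resp {xs} xs! φ ψ φ⇒ψ ψ⇒φ φ∈ ψ∈ = begin
    (∑[ x ∈ xs ] f (φ x))
      ≈⟨ ∑-cong xs (λ x → *-identityˡ _) ⟨
    (∑[ x ∈ xs ] 1# * f (φ x))
      ≈⟨ ∑-pushforward xs φ xs! φ∈ (λ _ → 1#) f-resp ⟨
    (∑[ y ∈ xs ] pushforward xs φ (λ _ → 1#) y * f y)
      ≈⟨ ∑-congAll (All.map (λ {y} ψy∈xs → trans (*-congʳ (trans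
           (∑-cong xs λ x → trans (*-identityʳ _) (𝟙-cong (y D.≟ φ x) (x D.≟ ψ y) φ⇒ψ ψ⇒φ))
           (∑-δ xs! ψy∈xs))) (*-identityˡ _)) ψ∈) ⟩
    ∑ xs f ∎

-- The finite field, its vector spaces and normalised hyperplanes

module FiniteFieldProperties {a ℓ} {q : ℕ} (𝔽 : FiniteField a ℓ q) where
  open FiniteField 𝔽
  open AffineSpace 𝔽
  open Membership setoid using (_∈_)
  open SetoidReasoning setoid

  elements-unique : Unique.Unique setoid elements
  elements-unique = Uniqueₚ.map⁺ (≡.setoid _) setoid
    (λ {i} {j} eq → ≡.trans (≡.sym (Inverse.strictlyInverseˡ enumeration i))
      (≡.trans (Inverse.to-cong enumeration eq) (Inverse.strictlyInverseˡ enumeration j)))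
    (Uniqueₚ.allFin⁺ q)

  ∈-elements : ∀ x → x ∈ elements
  ∈-elements x = ∈-resp-≈ setoid (Inverse.strictlyInverseʳ enumeration x)
    (∈-map⁺ (≡.setoid _) setoid (Inverse.from-cong enumeration)
      (∈-allFin (Inverse.to enumeration x)))

  length-elements : length elements ≡ q
  length-elements = ≡.trans (List.length-map _ (allFin q)) (List.length-tabulate _)

  nonzero? : ∀ x → Dec (¬ (x ≈ 0#))
  nonzero? x = ¬? (x ≟ 0#)

  nonzero-resp : ∀ {x y} → x ≈ y → ¬ (x ≈ 0#) → ¬ (y ≈ 0#)
  nonzero-resp x≈y x≉0 y≈0 = x≉0 (trans x≈y y≈0)

  units : List Carrier
  units = filter nonzero? elements

  units-unique : Unique.Unique setoid units
  units-unique = Uniqueₚ.filter⁺ setoid nonzero? elements-unique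

  ∈-units : ∀ {x} → ¬ (x ≈ 0#) → x ∈ units
  ∈-units {x} = ∈-filter⁺ setoid nonzero? nonzero-resp (∈-elements x)

  units-nonzero : All (λ x → ¬ (x ≈ 0#)) units
  units-nonzero = All.all-filter nonzero? elements

  length-units≤ : length units ℕ.≤ q
  length-units≤ = ≡.subst (length units ℕ.≤_) length-elements (List.length-filter nonzero? elements)

  -- Junk value 0 at 0.
  recip : Carrier → Carrier
  recip x with x ≟ 0#
  ... | yes _  = 0#
  ... | no x≉0 = proj₁ (inverse x x≉0)

  recip-inverseʳ : ∀ {x} → ¬ (x ≈ 0#) → x * recip x ≈ 1#
  recip-inverseʳ {x} x≉0 with x ≟ 0#
  ... | yes x≈0 = contradiction x≈0 x≉0
  ... | no x≉0′ = proj₂ (inverse x x≉0′)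

  cancelʳ : ∀ {u} x → ¬ (u ≈ 0#) → x * u * recip u ≈ x
  cancelʳ {u} x u≉0 = begin
    x * u * recip u    ≈⟨ *-assoc x u _ ⟩
    x * (u * recip u)  ≈⟨ *-congˡ (recip-inverseʳ u≉0) ⟩
    x * 1#             ≈⟨ *-identityʳ x ⟩
    x                  ∎

  cancelʳ′ : ∀ {u} x → ¬ (u ≈ 0#) → x * recip u * u ≈ x
  cancelʳ′ {u} x u≉0 = begin
    x * recip u * u    ≈⟨ *-assoc x _ u ⟩
    x * (recip u * u)  ≈⟨ *-congˡ (*-comm _ u) ⟩
    x * (u * recip u)  ≈⟨ *-assoc x u _ ⟨
    x * u * recip u    ≈⟨ cancelʳ x u≉0 ⟩
    x                  ∎

  *-nonzero : ∀ {x y} → ¬ (x ≈ 0#) → ¬ (y ≈ 0#) → ¬ (x * y ≈ 0#)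
  *-nonzero {x} {y} x≉0 y≉0 xy≈0 = x≉0 (begin
    x               ≈⟨ cancelʳ x y≉0 ⟨
    x * y * recip y ≈⟨ *-congʳ xy≈0 ⟩
    0# * recip y    ≈⟨ zeroˡ _ ⟩
    0#              ∎)

  recip-nonzero : ∀ {x} → ¬ (x ≈ 0#) → ¬ (recip x ≈ 0#)
  recip-nonzero {x} x≉0 r≈0 = 1≉0 (begin
    1#          ≈⟨ recip-inverseʳ x≉0 ⟨
    x * recip x ≈⟨ *-congˡ r≈0 ⟩
    x * 0#      ≈⟨ zeroʳ x ⟩
    0#          ∎)

  allPoints-unique : ∀ d → Unique.Unique (≋-setoid d) (allPoints d)
  allPoints-unique zero    = [] ∷ []
  allPoints-unique (suc d) = Uniqueₚ.cartesianProductWith⁺ setoid (≋-setoid d) (≋-setoid (suc d))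
    _∷_ (λ { (x≈y ∷ xs≋ys) → x≈y , xs≋ys }) elements-unique (allPoints-unique d)

  ∈-allPoints : ∀ {d} (x : Point d) → Membership._∈_ (≋-setoid d) x (allPoints d)
  ∈-allPoints []      = here []
  ∈-allPoints {suc d} (x ∷ xs) = ∈-cartesianProductWith⁺ setoid (≋-setoid d) (≋-setoid (suc d))
    _∷_ (∈-elements x) (∈-allPoints xs)

  module _ {d : ℕ} where
    private module V = Setoid (≋-setoid d)

    nonorigin? : (x : Point d) → Dec (¬ (x ≋ origin d))
    nonorigin? x = ¬? (x ≋? origin d)

    nonzeroPoints-unique : Unique.Unique (≋-setoid d) (nonzeroPoints d)
    nonzeroPoints-unique = Uniqueₚ.filter⁺ (≋-setoid d) nonorigin? (allPoints-unique d)

    ∈-nonzeroPoints : ∀ {x} → ¬ (x ≋ origin d) → Membership._∈_ (≋-setoid d) x (nonzeroPoints d)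
    ∈-nonzeroPoints {x} = ∈-filter⁺ (≋-setoid d) nonorigin?
      (λ x≋y x≉0 y≋0 → x≉0 (V.trans x≋y y≋0)) (∈-allPoints x)

  infixr 7 _·_

  _·_ : ∀ {d} → Carrier → Point d → Point d
  t · v = Vec.map (t *_) v

  ·-cong : ∀ {d s t} {v w : Point d} → s ≈ t → v ≋ w → s · v ≋ t · w
  ·-cong s≈t []            = []
  ·-cong s≈t (x≈y ∷ xs≋ys) = *-cong s≈t x≈y ∷ ·-cong s≈t xs≋ys

  ·-assoc : ∀ {d} s t (v : Point d) → (s * t) · v ≋ s · t · v
  ·-assoc s t []      = []
  ·-assoc s t (x ∷ v) = *-assoc s t x ∷ ·-assoc s t v

  ·-identity : ∀ {d} (v : Point d) → 1# · v ≋ v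
  ·-identity []      = []
  ·-identity (x ∷ v) = *-identityˡ x ∷ ·-identity v

  ·-origin : ∀ d t → t · origin d ≋ origin d
  ·-origin zero    t = []
  ·-origin (suc d) t = zeroʳ t ∷ ·-origin d t

  ∙-cong : ∀ {d} {v w x y : Point d} → v ≋ w → x ≋ y → v ∙ x ≈ w ∙ y
  ∙-cong []            []              = refl
  ∙-cong (v≈w ∷ vs≋ws) (x≈y ∷ xs≋ys) = +-cong (*-cong v≈w x≈y) (∙-cong vs≋ws xs≋ys)

  ∙-homogeneous : ∀ {d} t (v x : Point d) → (t · v) ∙ x ≈ t * (v ∙ x)
  ∙-homogeneous t []      []      = sym (zeroʳ t)
  ∙-homogeneous t (v ∷ vs) (x ∷ xs) =
    trans (+-cong (*-assoc t v x) (∙-homogeneous t vs xs)) (sym (distribˡ t _ _))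

  ·-cancel : ∀ {d t} {v w : Point d} → ¬ (t ≈ 0#) → t · v ≋ t · w → v ≋ w
  ·-cancel {d} {t} {v} {w} t≉0 tv≋tw =
    V.trans (undo v) (V.trans (·-cong refl tv≋tw) (V.sym (undo w)))
    where
    module V = Setoid (≋-setoid d)
    undo : ∀ u → u ≋ recip t · t · u
    undo u = V.trans (V.sym (·-identity u)) (V.trans
      (·-cong (trans (sym (recip-inverseʳ t≉0)) (*-comm t _)) V.refl) (·-assoc _ t u))

  ·-nonorigin : ∀ {d t} {v : Point d} → ¬ (t ≈ 0#) → ¬ (v ≋ origin d) → ¬ (t · v ≋ origin d)
  ·-nonorigin {d} {t} t≉0 v≉0 tv≋0 =
    v≉0 (·-cancel t≉0 (V.trans tv≋0 (V.sym (·-origin d t))))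
    where module V = Setoid (≋-setoid d)

  monicNormal : ∀ {d} → Hyperplane d → Point d
  monicNormal h = recip (offset h) · normal h

  module _ {d} {h : Hyperplane d} (b≉0 : ¬ (offset h ≈ 0#)) where

    ∈ₕ⇒monicNormal∙≈1 : ∀ {x} → x ∈ₕ h → monicNormal h ∙ x ≈ 1#
    ∈ₕ⇒monicNormal∙≈1 {x} x∈h = begin
      monicNormal h ∙ x                   ≈⟨ ∙-homogeneous _ (normal h) x ⟩
      recip (offset h) * (normal h ∙ x)   ≈⟨ *-congˡ x∈h ⟩
      recip (offset h) * offset h         ≈⟨ *-comm _ _ ⟩
      offset h * recip (offset h)         ≈⟨ recip-inverseʳ b≉0 ⟩
      1#                                  ∎

    monicNormal∙≈1⇒∈ₕ : ∀ {x} → monicNormal h ∙ x ≈ 1# → x ∈ₕ h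
    monicNormal∙≈1⇒∈ₕ {x} v∙x≈1 = begin
      normal h ∙ x                                    ≈⟨ cancelʳ′ _ b≉0 ⟨
      (normal h ∙ x) * recip (offset h) * offset h    ≈⟨ *-congʳ (*-comm _ _) ⟩
      recip (offset h) * (normal h ∙ x) * offset h    ≈⟨ *-congʳ (∙-homogeneous _ (normal h) x) ⟨
      (monicNormal h ∙ x) * offset h                  ≈⟨ *-congʳ v∙x≈1 ⟩
      1# * offset h                                   ≈⟨ *-identityˡ _ ⟩
      offset h                                        ∎

    monicNormal-nonorigin : ¬ (monicNormal h ≋ origin d)
    monicNormal-nonorigin = ·-nonorigin (recip-nonzero b≉0) (normal≉0 h)

  -- With the offset scaled to 1 the vector alone determines which points lie on the hyperplane, so
  -- equal vectors would give two listed hyperplanes with the same points.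
  monicNormals-unique : ∀ {d} {hs : List (Hyperplane d)} →
    All (λ h → ¬ (offset h ≈ 0#)) hs → AllPairs (λ h h′ → ¬ ((_∈ₕ h) ≐ (_∈ₕ h′))) hs →
    Unique.Unique (≋-setoid d) (List.map monicNormal hs)
  monicNormals-unique             []           []           = []
  monicNormals-unique {d} {h ∷ hs} (b≉0 ∷ bs≉0) (h≠hs ∷ hs!) =
    All.map⁺ (All.zipWith (λ {h′} → distinct {h′}) (bs≉0 , h≠hs)) ∷ monicNormals-unique bs≉0 hs!
    where
    module V = Setoid (≋-setoid d)
    distinct : ∀ {h′} → ¬ (offset h′ ≈ 0#) Product.× ¬ ((_∈ₕ h) ≐ (_∈ₕ h′)) →
               ¬ (monicNormal h ≋ monicNormal h′)
    distinct {h′} (b′≉0 , h≠h′) v≋v′ = h≠h′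
      ( (λ x∈h → monicNormal∙≈1⇒∈ₕ {h = h′} b′≉0
          (trans (∙-cong (V.sym v≋v′) V.refl) (∈ₕ⇒monicNormal∙≈1 {h = h} b≉0 x∈h)))
      , (λ x∈h′ → monicNormal∙≈1⇒∈ₕ {h = h} b≉0
          (trans (∙-cong v≋v′ V.refl) (∈ₕ⇒monicNormal∙≈1 {h = h′} b′≉0 x∈h′))) )

All-cartesianProduct : ∀ {a b p q r} {A : Set a} {B : Set b} {P : Pred A p} {Q : Pred B q}
  {R : Pred (A Product.× B) r} → (∀ {x y} → P x → Q y → R (x , y)) →
  ∀ {xs ys} → All P xs → All Q ys → All R (cartesianProduct xs ys)
All-cartesianProduct f []         qs = []
All-cartesianProduct f (px ∷ pxs) qs =
  All.++⁺ (All.map⁺ (All.map (f px) qs)) (All-cartesianProduct f pxs qs)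

-- Orthogonality of additive characters

module CharacterSums
  {c ℓ₁ ℓ₂ a ℓ} (ℝ : RealField c ℓ₁ ℓ₂) (power : RealPower ℝ) {q : ℕ} (𝔽 : FiniteField a ℓ q)
  (character : Fourier.NontrivialAdditiveCharacter ℝ power 𝔽)
  where
  open RealField ℝ
  open RealFieldProperties ℝ
  open FiniteSums ℝ
  open IntegerSolver commutativeRing
  open SetoidReasoning setoid
  open Complex ℝ power using (re; im)
  open AffineSpace 𝔽
  open FiniteFieldProperties 𝔽
  open Fourier.NontrivialAdditiveCharacter character
  private
    module 𝔽 = FiniteField 𝔽
    module 𝔽ₚ = RingProperties 𝔽.ring
    module K = KroneckerSums ℝ 𝔽.decSetoid
  open Membership 𝔽.setoid using (_∈_)

  -- Named after the addition formulas `cos-+` and `sin-+`, which are the real and imaginary parts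
  -- of multiplicativity of χ.
  cos sin : 𝔽.Carrier → Carrier
  cos x = re (χ x)
  sin x = im (χ x)

  cos-cong : K.Respectful cos
  cos-cong x≈y = proj₁ (χ-cong x≈y)

  sin-cong : K.Respectful sin
  sin-cong x≈y = proj₂ (χ-cong x≈y)

  cos-+ : ∀ x y → cos (x 𝔽.+ y) ≈ cos x * cos y - sin x * sin y
  cos-+ x y = proj₁ (χ-+ x y)

  sin-+ : ∀ x y → sin (x 𝔽.+ y) ≈ cos x * sin y + sin x * cos y
  sin-+ x y = proj₂ (χ-+ x y)

  ∑-translate : ∀ {f} → K.Respectful f → ∀ u →
    (∑[ x ∈ 𝔽.elements ] f (u 𝔽.+ x)) ≈ ∑ 𝔽.elements f
  ∑-translate f-resp u = K.∑-reindex f-resp elements-unique (u 𝔽.+_) (𝔽.- u 𝔽.+_)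
    (λ y≈u+x → 𝔽.trans (𝔽.sym (undo _)) (𝔽.+-congˡ (𝔽.sym y≈u+x)))
    (λ x≈-u+y → 𝔽.trans (𝔽.sym (redo _)) (𝔽.+-congˡ (𝔽.sym x≈-u+y)))
    (All.universal (λ x → ∈-elements _) _) (All.universal (λ x → ∈-elements _) _)
    where
    undo : ∀ x → 𝔽.- u 𝔽.+ (u 𝔽.+ x) 𝔽.≈ x
    undo x = 𝔽.trans (𝔽.sym (𝔽.+-assoc _ _ _)) (𝔽.trans (𝔽.+-congʳ (𝔽.-‿inverseˡ u)) (𝔽.+-identityˡ x))
    redo : ∀ x → u 𝔽.+ (𝔽.- u 𝔽.+ x) 𝔽.≈ x
    redo x = 𝔽.trans (𝔽.sym (𝔽.+-assoc _ _ _)) (𝔽.trans (𝔽.+-congʳ (𝔽.-‿inverseʳ u)) (𝔽.+-identityˡ x))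

  ∑-dilate : ∀ {f} → K.Respectful f → ∀ {xs} → Unique.Unique 𝔽.setoid xs →
    ∀ {u} → ¬ (u 𝔽.≈ 𝔽.0#) →
    All (λ x → x 𝔽.* u ∈ xs) xs → All (λ x → x 𝔽.* recip u ∈ xs) xs →
    (∑[ x ∈ xs ] f (x 𝔽.* u)) ≈ ∑ xs f
  ∑-dilate f-resp xs! {u} u≉0 = K.∑-reindex f-resp xs! (𝔽._* u) (𝔽._* recip u)
    (λ y≈xu → 𝔽.trans (𝔽.sym (cancelʳ _ u≉0)) (𝔽.*-congʳ (𝔽.sym y≈xu)))
    (λ x≈y/u → 𝔽.trans (𝔽.sym (cancelʳ′ _ u≉0)) (𝔽.*-congʳ (𝔽.sym x≈y/u)))

  ∑-units-dilate : ∀ {f} → K.Respectful f → ∀ {u} → ¬ (u 𝔽.≈ 𝔽.0#) →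
    (∑[ x ∈ units ] f (x 𝔽.* u)) ≈ ∑ units f
  ∑-units-dilate f-resp u≉0 = ∑-dilate f-resp units-unique u≉0
    (All.map (λ x≉0 → ∈-units (*-nonzero x≉0 u≉0)) units-nonzero)
    (All.map (λ x≉0 → ∈-units (*-nonzero x≉0 (recip-nonzero u≉0))) units-nonzero)

  -- |χ|² is multiplicative, so its sum S over 𝔽 satisfies S = |χ(u)|² S, and S > 0.
  cos²+sin²≈1 : ∀ u → cos u * cos u + sin u * sin u ≈ 1#
  cos²+sin²≈1 u = begin
    N u                ≈⟨ solve 1 (λ n → n := (n :- con (+ 1)) :+ con (+ 1)) refl (N u) ⟩
    (N u - 1#) + 1#    ≈⟨ +-congʳ (x#0∧xy≈0⇒y≈0 (#-sym (<⇒# 0<S)) S[N-1]≈0) ⟩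
    0# + 1#            ≈⟨ +-identityˡ 1# ⟩
    1#                 ∎
    where
    N : 𝔽.Carrier → Carrier
    N x = cos x * cos x + sin x * sin x

    S : Carrier
    S = ∑ 𝔽.elements N

    N-resp : K.Respectful N
    N-resp x≈y = +-cong (*-cong (cos-cong x≈y) (cos-cong x≈y)) (*-cong (sin-cong x≈y) (sin-cong x≈y))

    0≤N : ∀ x → 0# ≤ N x
    0≤N x = +-nonneg (0≤x*x _) (0≤x*x _)

    N-+ : ∀ x → N (u 𝔽.+ x) ≈ N u * N x
    N-+ x = trans (+-cong (*-cong (cos-+ u x) (cos-+ u x)) (*-cong (sin-+ u x) (sin-+ u x)))
      (solve 4 (λ a b c s → (a :* c :- b :* s) :* (a :* c :- b :* s)
                            :+ (a :* s :+ b :* c) :* (a :* s :+ b :* c)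
                              := (a :* a :+ b :* b) :* (c :* c :+ s :* s))
        refl (cos u) (sin u) (cos x) (sin x))

    N0≈1 : N 𝔽.0# ≈ 1#
    N0≈1 = trans (+-cong (*-cong (proj₁ χ-0) (proj₁ χ-0)) (*-cong (proj₂ χ-0) (proj₂ χ-0)))
      (solve 0 (con (+ 1) :* con (+ 1) :+ con (+ 0) :* con (+ 0) := con (+ 1)) refl)

    0<S : 0# < S
    0<S = <-≤-trans 0<1 (≤-respˡ-≈ (trans (K.∑-δ* N-resp elements-unique (∈-elements 𝔽.0#)) N0≈1)
      (∑-mono 𝔽.elements λ x → 𝟙*≤ (x 𝔽.≟ 𝔽.0#) (0≤N x)))

    S[N-1]≈0 : S * (N u - 1#) ≈ 0#
    S[N-1]≈0 = begin
      S * (N u - 1#)  ≈⟨ solve 2 (λ s n → s :* (n :- con (+ 1)) := n :* s :- s) refl S (N u) ⟩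
      N u * S - S     ≈⟨ +-congʳ (trans (sym (∑-*ˡ (N u) N 𝔽.elements)) (trans
                           (∑-cong 𝔽.elements λ x → sym (N-+ x)) (∑-translate N-resp u))) ⟩
      S - S           ≈⟨ -‿inverseʳ S ⟩
      0#              ∎

  -- The conjugate of χ(y) is χ(-y): the two parts of χ(y) χ(-y) = 1 form a linear system for χ(-y)
  -- with determinant |χ(y)|² = 1.
  cos-difference : ∀ x y → cos x * cos y + sin x * sin y ≈ cos (x 𝔽.- y)
  cos-difference x y = begin
    cos x * cos y + sin x * sin y
      ≈⟨ +-cong (*-congˡ cos-neg) (*-congˡ sin-neg) ⟨
    cos x * c′ + sin x * - s′
      ≈⟨ solve 4 (λ a b c s → a :* c :+ b :* (:- s) := a :* c :- b :* s) refl _ _ _ _ ⟩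
    cos x * c′ - sin x * s′
      ≈⟨ cos-+ x (𝔽.- y) ⟨
    cos (x 𝔽.- y) ∎
    where
    c₀ s₀ c′ s′ : Carrier
    c₀ = cos y
    s₀ = sin y
    c′ = cos (𝔽.- y)
    s′ = sin (𝔽.- y)

    real : c₀ * c′ - s₀ * s′ ≈ 1#
    real = trans (sym (cos-+ y (𝔽.- y))) (trans (cos-cong (𝔽.-‿inverseʳ y)) (proj₁ χ-0))

    imaginary : c₀ * s′ + s₀ * c′ ≈ 0#
    imaginary = trans (sym (sin-+ y (𝔽.- y))) (trans (sin-cong (𝔽.-‿inverseʳ y)) (proj₂ χ-0))

    cos-neg : c′ ≈ c₀
    cos-neg = begin
      c′                                ≈⟨ *-identityˡ c′ ⟨
      1# * c′                           ≈⟨ *-congʳ (cos²+sin²≈1 y) ⟨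
      (c₀ * c₀ + s₀ * s₀) * c′
        ≈⟨ solve 4 (λ c s c′ s′ → (c :* c :+ s :* s) :* c′
             := c :* (c :* c′ :- s :* s′) :+ s :* (c :* s′ :+ s :* c′)) refl c₀ s₀ c′ s′ ⟩
      c₀ * (c₀ * c′ - s₀ * s′) + s₀ * (c₀ * s′ + s₀ * c′)
        ≈⟨ +-cong (*-congˡ real) (*-congˡ imaginary) ⟩
      c₀ * 1# + s₀ * 0#
        ≈⟨ solve 2 (λ c s → c :* con (+ 1) :+ s :* con (+ 0) := c) refl c₀ s₀ ⟩
      c₀ ∎

    sin-neg : - s′ ≈ s₀
    sin-neg = begin
      - s′                              ≈⟨ *-identityˡ _ ⟨
      1# * - s′                         ≈⟨ *-congʳ (cos²+sin²≈1 y) ⟨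
      (c₀ * c₀ + s₀ * s₀) * - s′
        ≈⟨ solve 4 (λ c s c′ s′ → (c :* c :+ s :* s) :* (:- s′)
             := s :* (c :* c′ :- s :* s′) :- c :* (c :* s′ :+ s :* c′)) refl c₀ s₀ c′ s′ ⟩
      s₀ * (c₀ * c′ - s₀ * s′) - c₀ * (c₀ * s′ + s₀ * c′)
        ≈⟨ +-cong (*-congˡ real) (-‿cong (*-congˡ imaginary)) ⟩
      s₀ * 1# - c₀ * 0#
        ≈⟨ solve 2 (λ c s → s :* con (+ 1) :- c :* con (+ 0) := s) refl c₀ s₀ ⟩
      s₀ ∎

  -- Translation by `u` multiplies the sum of χ by χ(u) but only permutes its terms, so χ(u) - 1
  -- annihilates it. Multiplying by the conjugate of χ(u) - 1 and taking real parts isolates the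
  -- cosine sum with the coefficient |χ(u) - 1|².
  ∑cos≈0 : ∑ 𝔽.elements cos ≈ 0#
  ∑cos≈0 with nontrivial
  ... | u , χu≉1 = x≉0∧xy≈0⇒y≈0 {(α - 1#) * (α - 1#) + β * β} norm≉0 (begin
    ((α - 1#) * (α - 1#) + β * β) * C
      ≈⟨ solve 4 (λ α β C S → ((α :- con (+ 1)) :* (α :- con (+ 1)) :+ β :* β) :* C
           := (α :- con (+ 1)) :* ((α :* C :+ (:- β) :* S) :- C) :+ β :* ((α :* S :+ β :* C) :- S))
           refl α β C S ⟩
    (α - 1#) * ((α * C + - β * S) - C) + β * ((α * S + β * C) - S)
      ≈⟨ +-cong (*-congˡ (+-congʳ C-shift)) (*-congˡ (+-congʳ S-shift)) ⟩
    (α - 1#) * (C - C) + β * (S - S)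
      ≈⟨ solve 4 (λ α β C S → (α :- con (+ 1)) :* (C :- C) :+ β :* (S :- S) := con (+ 0)) refl α β C S ⟩
    0# ∎)
    where
    α = cos u
    β = sin u
    C = ∑ 𝔽.elements cos
    S = ∑ 𝔽.elements sin

    norm≉0 : ¬ ((α - 1#) * (α - 1#) + β * β ≈ 0#)
    norm≉0 eq = χu≉1
      ( trans (sym (x-y+y≈x α 1#)) (trans (+-congʳ (x*x+y*y≈0⇒x≈0 eq)) (+-identityˡ 1#))
      , x*x+y*y≈0⇒x≈0 (trans (+-comm _ _) eq) )

    C-shift : α * C + - β * S ≈ C
    C-shift = begin
      α * C + - β * S
        ≈⟨ +-cong (∑-*ˡ α cos 𝔽.elements) (∑-*ˡ (- β) sin 𝔽.elements) ⟨
      _ ≈⟨ ∑-+ _ _ 𝔽.elements ⟨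
      _ ≈⟨ ∑-cong 𝔽.elements (λ x → trans
             (solve 4 (λ α β c s → α :* c :+ (:- β) :* s := α :* c :- β :* s) refl α β _ _)
             (sym (cos-+ u x))) ⟩
      (∑[ x ∈ 𝔽.elements ] cos (u 𝔽.+ x)) ≈⟨ ∑-translate cos-cong u ⟩
      C ∎

    S-shift : α * S + β * C ≈ S
    S-shift = begin
      α * S + β * C
        ≈⟨ +-cong (∑-*ˡ α sin 𝔽.elements) (∑-*ˡ β cos 𝔽.elements) ⟨
      _ ≈⟨ ∑-+ _ _ 𝔽.elements ⟨
      _ ≈⟨ ∑-cong 𝔽.elements (λ x → sym (sin-+ u x)) ⟩
      (∑[ x ∈ 𝔽.elements ] sin (u 𝔽.+ x)) ≈⟨ ∑-translate sin-cong u ⟩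
      S ∎

  ∑-elements-cos : ∀ u → (∑[ t ∈ 𝔽.elements ] cos (t 𝔽.* u)) ≈ fromℕ q * 𝟙 (u 𝔽.≟ 𝔽.0#)
  ∑-elements-cos u with u 𝔽.≟ 𝔽.0#
  ... | yes u≈0 = begin
    (∑[ t ∈ 𝔽.elements ] cos (t 𝔽.* u))
      ≈⟨ ∑-cong 𝔽.elements (λ t → trans
           (cos-cong (𝔽.trans (𝔽.*-congˡ u≈0) (𝔽.zeroʳ t))) (proj₁ χ-0)) ⟩
    (∑[ t ∈ 𝔽.elements ] 1#)         ≈⟨ ∑-const 1# 𝔽.elements ⟩
    fromℕ (length 𝔽.elements) * 1#   ≡⟨ ≡.cong (λ n → fromℕ n * 1#) length-elements ⟩
    fromℕ q * 1#                     ∎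
  ... | no u≉0 = begin
    (∑[ t ∈ 𝔽.elements ] cos (t 𝔽.* u))
      ≈⟨ ∑-dilate cos-cong elements-unique u≉0
           (All.universal (λ x → ∈-elements _) _) (All.universal (λ x → ∈-elements _) _) ⟩
    ∑ 𝔽.elements cos  ≈⟨ ∑cos≈0 ⟩
    0#                ≈⟨ zeroʳ _ ⟨
    fromℕ q * 0#      ∎

  ∑-elements-split : ∀ {f} → K.Respectful f → ∑ 𝔽.elements f ≈ f 𝔽.0# + ∑ units f
  ∑-elements-split {f} f-resp = begin
    ∑ 𝔽.elements f
      ≈⟨ ∑-cong 𝔽.elements (λ x → split (x 𝔽.≟ 𝔽.0#) (f x)) ⟩
    (∑[ x ∈ 𝔽.elements ] 𝟙 (x 𝔽.≟ 𝔽.0#) * f x + 𝟙 (nonzero? x) * f x)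
      ≈⟨ ∑-+ _ _ 𝔽.elements ⟩
    _ ≈⟨ +-cong (K.∑-δ* f-resp elements-unique (∈-elements 𝔽.0#))
                (sym (∑-filter nonzero? f 𝔽.elements)) ⟩
    f 𝔽.0# + ∑ units f ∎
    where
    split : ∀ {p} {P : Set p} (P? : Dec P) z → z ≈ 𝟙 P? * z + 𝟙 (¬? P?) * z
    split (yes _) z = solve 1 (λ z → z := con (+ 1) :* z :+ con (+ 0) :* z) refl z
    split (no _)  z = solve 1 (λ z → z := con (+ 0) :* z :+ con (+ 1) :* z) refl z

  -- The term t = 0 is kept apart because it plays its own role: summed over points and hyperplanes
  -- it gives the main term |P||H|.
  ∑-units-cos : ∀ u → 1# + (∑[ t ∈ units ] cos (t 𝔽.* u)) ≈ fromℕ q * 𝟙 (u 𝔽.≟ 𝔽.0#)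
  ∑-units-cos u = begin
    1# + (∑[ t ∈ units ] cos (t 𝔽.* u))
      ≈⟨ +-congʳ (trans (cos-cong (𝔽.zeroˡ u)) (proj₁ χ-0)) ⟨
    cos (𝔽.0# 𝔽.* u) + (∑[ t ∈ units ] cos (t 𝔽.* u))
      ≈⟨ ∑-elements-split (λ s≈t → cos-cong (𝔽.*-congʳ s≈t)) ⟨
    (∑[ t ∈ 𝔽.elements ] cos (t 𝔽.* u))
      ≈⟨ ∑-elements-cos u ⟩
    fromℕ q * 𝟙 (u 𝔽.≟ 𝔽.0#) ∎

  -- Dilated normals, their collisions and the deviation from the main term

  module _ {d : ℕ} where
    private
      module V = DecSetoid (VecEquality.≋-decSetoid 𝔽.decSetoid d)
      module Kᵈ = KroneckerSums ℝ (VecEquality.≋-decSetoid 𝔽.decSetoid d)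

    dilates : List (Point d) → List (Point d Product.× 𝔽.Carrier)
    dilates vs = cartesianProduct vs units

    dilate : Point d Product.× 𝔽.Carrier → Point d
    dilate (v , t) = t · v

    fromℕ-length-dilates : ∀ vs →
      fromℕ (length (dilates vs)) ≤ fromℕ (length vs) * fromℕ q
    fromℕ-length-dilates vs = ≤-respˡ-≈ (sym (begin
      fromℕ (length (dilates vs))       ≈⟨ fromℕ-length (dilates vs) ⟩
      (∑[ j ∈ dilates vs ] 1#)          ≈⟨ ∑-cartesianProduct _ vs units ⟩
      (∑[ v ∈ vs ] ∑[ t ∈ units ] 1#)   ≈⟨ ∑-cong vs (λ v → fromℕ-length units) ⟨
      (∑[ v ∈ vs ] fromℕ (length units)) ≈⟨ ∑-const _ vs ⟩
      fromℕ (length vs) * fromℕ (length units) ∎))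
      (*-mono-≤ (0≤fromℕ (length vs)) (0≤fromℕ (length units)) ≤-refl (fromℕ-mono-≤ length-units≤))

    -- For t′ = r t the points t v and t′ v′ agree iff v = r v′, and the sum over t of
    -- cos (t (1 − r)) is −1 unless r = 1.
    ∑-pair-collisions≤ : ∀ (v v′ : Point d) →
      (∑[ t ∈ units ] ∑[ t′ ∈ units ] 𝟙 (t · v ≋? t′ · v′) * cos (t 𝔽.- t′))
        ≤ fromℕ q * 𝟙 (v′ ≋? v)
    ∑-pair-collisions≤ v v′ = ≤-respˡ-≈ (sym (begin
      (∑[ t ∈ units ] ∑[ t′ ∈ units ] 𝟙 (t · v ≋? t′ · v′) * cos (t 𝔽.- t′))
        ≈⟨ ∑-congAll (All.map (λ {t} t≉0 → trans
             (sym (∑-units-dilate (term-resp t) t≉0)) (∑-cong units (factor t≉0))) units-nonzero) ⟩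
      (∑[ t ∈ units ] ∑[ r ∈ units ] 𝟙 (v ≋? r · v′) * cos (t 𝔽.* (𝔽.1# 𝔽.- r)))
        ≈⟨ ∑-swap _ units units ⟩
      (∑[ r ∈ units ] ∑[ t ∈ units ] 𝟙 (v ≋? r · v′) * cos (t 𝔽.* (𝔽.1# 𝔽.- r)))
        ≈⟨ ∑-cong units (λ r → ∑-*ˡ _ _ units) ⟩
      (∑[ r ∈ units ] 𝟙 (v ≋? r · v′) * (∑[ t ∈ units ] cos (t 𝔽.* (𝔽.1# 𝔽.- r)))) ∎))
      (≤-trans (∑-mono units bound) (≤-reflexive (begin
      (∑[ r ∈ units ] fromℕ q * (𝟙 (r 𝔽.≟ 𝔽.1#) * 𝟙 (v ≋? r · v′)))
        ≈⟨ ∑-*ˡ (fromℕ q) _ units ⟩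
      fromℕ q * (∑[ r ∈ units ] 𝟙 (r 𝔽.≟ 𝔽.1#) * 𝟙 (v ≋? r · v′))
        ≈⟨ *-congˡ (K.∑-δ* (λ {r} {r′} r≈r′ → 𝟙-cong (v ≋? r · v′) (v ≋? r′ · v′)
             (λ v≋ → V.trans v≋ (·-cong r≈r′ V.refl))
             (λ v≋ → V.trans v≋ (·-cong (𝔽.sym r≈r′) V.refl))) units-unique (∈-units 𝔽.1≉0)) ⟩
      fromℕ q * 𝟙 (v ≋? 𝔽.1# · v′)
        ≈⟨ *-congˡ (𝟙-cong (v ≋? 𝔽.1# · v′) (v′ ≋? v)
             (λ v≋ → V.sym (V.trans v≋ (·-identity v′)))
             (λ v′≋v → V.trans (V.sym v′≋v) (V.sym (·-identity v′)))) ⟩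
      fromℕ q * 𝟙 (v′ ≋? v) ∎)))
      where
      term-resp : ∀ t → K.Respectful (λ t′ → 𝟙 (t · v ≋? t′ · v′) * cos (t 𝔽.- t′))
      term-resp t {x} {y} x≈y = *-cong
        (𝟙-cong (t · v ≋? x · v′) (t · v ≋? y · v′)
          (λ eq → V.trans eq (·-cong x≈y V.refl))
          (λ eq → V.trans eq (·-cong (𝔽.sym x≈y) V.refl)))
        (cos-cong (𝔽.+-congˡ (𝔽.-‿cong x≈y)))

      factor : ∀ {t} → ¬ (t 𝔽.≈ 𝔽.0#) → ∀ r →
        𝟙 (t · v ≋? (r 𝔽.* t) · v′) * cos (t 𝔽.- r 𝔽.* t)
          ≈ 𝟙 (v ≋? r · v′) * cos (t 𝔽.* (𝔽.1# 𝔽.- r))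
      factor {t} t≉0 r = *-cong
        (𝟙-cong (t · v ≋? (r 𝔽.* t) · v′) (v ≋? r · v′)
          (λ eq → ·-cancel t≉0 (V.trans eq rt≋))
          (λ eq → V.trans (·-cong 𝔽.refl eq) (V.sym rt≋)))
        (cos-cong (𝔽.sym (𝔽.trans (𝔽.distribˡ t _ _)
          (𝔽.+-cong (𝔽.*-identityʳ t)
            (𝔽.trans (𝔽.sym (𝔽ₚ.-‿distribʳ-* t r)) (𝔽.-‿cong (𝔽.*-comm t r)))))))
        where
        rt≋ : (r 𝔽.* t) · v′ ≋ t · r · v′
        rt≋ = V.trans (·-cong (𝔽.*-comm r t) V.refl) (·-assoc t r v′)

      𝟙*-mono : ∀ {p} {P : Set p} (P? : Dec P) {x y} → x ≤ y → 𝟙 P? * x ≤ y * 𝟙 P?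
      𝟙*-mono P? x≤y = ≤-respˡ-≈ (*-comm _ _) (*-monoˡ-≤ (0≤𝟙 P?) x≤y)

      bound : ∀ r →
        𝟙 (v ≋? r · v′) * (∑[ t ∈ units ] cos (t 𝔽.* (𝔽.1# 𝔽.- r)))
          ≤ fromℕ q * (𝟙 (r 𝔽.≟ 𝔽.1#) * 𝟙 (v ≋? r · v′))
      bound r = ≤-respʳ-≈ (*-assoc _ _ _) (𝟙*-mono (v ≋? r · v′)
        -- Adding 1 completes the sum to all of the field: q - 1 becomes q at r = 1, and -1 becomes
        -- 0 at every other r.
        (≤-trans (≤-respˡ-≈ (+-identityˡ _) (+-monoˡ-≤ _ (<⇒≤ 0<1)))
          (≤-reflexive (trans (∑-units-cos (𝔽.1# 𝔽.- r)) (*-congˡ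
            (𝟙-cong (𝔽.1# 𝔽.- r 𝔽.≟ 𝔽.0#) (r 𝔽.≟ 𝔽.1#)
              (λ eq → 𝔽.sym (GroupProperties.x∙y⁻¹≈ε⇒x≈y 𝔽.+-group _ _ eq)) (λ eq → 𝔽.trans (𝔽.+-congˡ (𝔽.-‿cong eq)) (𝔽.-‿inverseʳ 𝔽.1#))))))))

    -- The real part of χ(t) S is cos t · Re S - sin t · Im S; the sign is put into the weight so
    -- that this is a plain inner product of pairs.
    cosᵈ -sinᵈ : Point d Product.× 𝔽.Carrier → Carrier
    cosᵈ  (v , t) = cos t
    -sinᵈ (v , t) = - sin t

    -- This is Σ|G|² ≤ q|H|: for each v the pair bound vanishes unless v′ equals v, and in a list
    -- without repetitions that happens once.
    dilate-collisions≤ : ∀ {vs} → Unique.Unique (≋-setoid d) vs →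
      Kᵈ.collisions (dilates vs) dilate cosᵈ -sinᵈ ≤ fromℕ (length vs) * fromℕ q
    dilate-collisions≤ {vs} vs! = ≤-respˡ-≈ (sym rearranged) (≤-trans
      (∑-monoAll (tabulateₛ V.setoid λ {v} v∈vs → ≤-trans
        (∑-mono vs (∑-pair-collisions≤ v))
        (≤-reflexive (trans (∑-*ˡ (fromℕ q) _ vs)
          (trans (*-congˡ (Kᵈ.∑-δ vs! v∈vs)) (*-identityʳ _))))))
      (≤-reflexive (∑-const (fromℕ q) vs)))
      where
      rearranged : Kᵈ.collisions (dilates vs) dilate cosᵈ -sinᵈ ≈
        (∑[ v ∈ vs ] ∑[ v′ ∈ vs ] ∑[ t ∈ units ] ∑[ t′ ∈ units ]
          𝟙 (t · v ≋? t′ · v′) * cos (t 𝔽.- t′))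
      rearranged = trans (∑-cartesianProduct _ vs units) (∑-cong vs λ v → trans
        (∑-cong units λ t → ∑-cartesianProduct _ vs units) (trans
        (∑-swap _ units vs)
        (∑-cong vs λ v′ → ∑-cong units λ t → ∑-cong units λ t′ → *-congˡ (trans
          (solve 4 (λ a b c d → a :* b :+ (:- c) :* (:- d) := a :* b :+ c :* d) refl _ _ _ _)
          (cos-difference t t′)))))

    realTransform imTransform : List (Point d) → Point d → Carrier
    realTransform ps x = ∑[ y ∈ ps ] cos (𝔽.- (x ∙ y))
    imTransform   ps x = ∑[ y ∈ ps ] sin (𝔽.- (x ∙ y))

    normTransform² : List (Point d) → Point d → Carrier
    normTransform² ps x =
      realTransform ps x * realTransform ps x + imTransform ps x * imTransform ps x

    -- The real part of Σ_v Σ_{t≠0} χ(t) S(t v), with the sum over `ps` written out; it is the error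
    -- in q I(P,H) ≈ |P||H|.
    deviation : List (Point d) → List (Point d) → Carrier
    deviation ps vs =
      ∑[ v ∈ vs ] ∑[ t ∈ units ] ∑[ y ∈ ps ] cos (t 𝔽.* (𝔽.1# 𝔽.- v ∙ y))

    -- The phase t(1 - v · y) equals t - (t v) · y, so χ splits into χ(t) and a term of the
    -- transform at t v.
    deviation-fourier : ∀ ps vs → deviation ps vs ≈
      (∑[ j ∈ dilates vs ] cosᵈ j * realTransform ps (dilate j) + -sinᵈ j * imTransform ps (dilate j))
    deviation-fourier ps vs = trans
      (∑-cong vs λ v → ∑-cong units λ t → begin
        (∑[ y ∈ ps ] cos (t 𝔽.* (𝔽.1# 𝔽.- v ∙ y)))
          ≈⟨ ∑-cong ps (λ y → trans (cos-cong (phase v t y)) (trans (cos-+ t _)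
               (solve 4 (λ a b c d → a :* b :- c :* d := a :* b :+ (:- c) :* d) refl _ _ _ _))) ⟩
        (∑[ y ∈ ps ] cos t * cos (𝔽.- ((t · v) ∙ y)) + - sin t * sin (𝔽.- ((t · v) ∙ y)))
          ≈⟨ ∑-+ _ _ ps ⟩
        _ ≈⟨ +-cong (∑-*ˡ _ _ ps) (∑-*ˡ _ _ ps) ⟩
        cos t * realTransform ps (t · v) + - sin t * imTransform ps (t · v) ∎)
      (sym (∑-cartesianProduct _ vs units))
      where
      phase : ∀ v t y → t 𝔽.* (𝔽.1# 𝔽.- v ∙ y) 𝔽.≈ t 𝔽.- (t · v) ∙ y
      phase v t y = 𝔽.trans (𝔽.distribˡ t _ _) (𝔽.+-cong (𝔽.*-identityʳ t)
        (𝔽.trans (𝔽.sym (𝔽ₚ.-‿distribʳ-* t _)) (𝔽.-‿cong (𝔽.sym (∙-homogeneous t v y)))))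

    -- Two of the three factors q|H| come from the collision bound, squared, and the third from the
    -- number of dilates. Nonzero multiples of nonzero vectors stay in `nonzeroPoints`, the range of
    -- the Salem norm.
    deviation⁴≤ : ∀ ps {vs} → Unique.Unique (≋-setoid d) vs →
      All (λ v → ¬ (v ≋ origin d)) vs →
      deviation ps vs ^ 4 ≤ (fromℕ (length vs) * fromℕ q) ^ 3 *
        (∑[ x ∈ nonzeroPoints d ] normTransform² ps x * normTransform² ps x)
    deviation⁴≤ ps {vs} vs! vs≉0 = ≤-respˡ-≈ (^-congˡ 4 (sym (deviation-fourier ps vs))) (≤-trans
      (Kᵈ.fourthMoment-≤ (dilates vs) dilate nonzeroPoints-unique dilates∈ cosᵈ -sinᵈ
        (λ x≋y → ∑-cong ps λ y → cos-cong (𝔽.-‿cong (∙-cong x≋y V.refl)))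
        (λ x≋y → ∑-cong ps λ y → sin-cong (𝔽.-‿cong (∙-cong x≋y V.refl)))
        (dilate-collisions≤ vs!))
      (≤-respʳ-≈ (solve 2 (λ n m → n :* n :* (n :* m) := n :^ 3 :* m) refl nq _)
        (*-mono-≤ (*-nonneg 0≤nq 0≤nq)
          (*-nonneg (0≤fromℕ (length (dilates vs))) 0≤M)
          ≤-refl
          (*-monoˡ-≤ 0≤M (fromℕ-length-dilates vs)))))
      where
      nq : Carrier
      nq = fromℕ (length vs) * fromℕ q

      0≤nq : 0# ≤ nq
      0≤nq = *-nonneg (0≤fromℕ (length vs)) (0≤fromℕ q)

      dilates∈ : All (λ j → Membership._∈_ V.setoid (dilate j) (nonzeroPoints d)) (dilates vs)
      dilates∈ = All-cartesianProduct
        (λ v≉0 t≉0 → ∈-nonzeroPoints (·-nonorigin t≉0 v≉0)) vs≉0 units-nonzero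

      0≤M : 0# ≤ (∑[ x ∈ nonzeroPoints d ] normTransform² ps x * normTransform² ps x)
      0≤M = ∑-nonneg (nonzeroPoints d) λ x → 0≤x*x _

    -- By orthogonality, 1 plus the sum over units is q for an incident pair and 0 for any other;
    -- the count is kept multiplied by q to postpone the division.
    fromℕ-q*incidences : ∀ (P : PointSet d) (H : HyperplaneSet d) → NonzeroOffsets H →
      fromℕ q * fromℕ (incidences P H) ≈
        fromℕ (#ᴾ P) * fromℕ (#ᴴ H) + deviation (points P) (List.map monicNormal (hyperplanes H))
    fromℕ-q*incidences P H bs≉0 = begin
      fromℕ q * fromℕ (incidences P H)
        ≈⟨ *-congˡ (trans (fromℕ-length-filter (uncurry _∈ₕ?_) (cartesianProduct ps hs))
             (trans (∑-cartesianProduct _ ps hs) (∑-swap _ ps hs))) ⟩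
      fromℕ q * (∑[ h ∈ hs ] ∑[ y ∈ ps ] 𝟙 (y ∈ₕ? h))
        ≈⟨ trans (sym (∑-*ˡ _ _ hs)) (∑-cong hs λ h → sym (∑-*ˡ _ _ ps)) ⟩
      (∑[ h ∈ hs ] ∑[ y ∈ ps ] fromℕ q * 𝟙 (y ∈ₕ? h))
        ≈⟨ ∑-congAll (All.map (λ {h} b≉0 → ∑-cong ps (detect {h} b≉0)) bs≉0) ⟩
      (∑[ h ∈ hs ] ∑[ y ∈ ps ] 1# + (∑[ t ∈ units ] cos (t 𝔽.* (𝔽.1# 𝔽.- monicNormal h ∙ y))))
        ≈⟨ ∑-cong hs (λ h → trans (∑-+ _ _ ps)
             (+-cong (sym (fromℕ-length ps)) (∑-swap _ ps units))) ⟩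
      (∑[ h ∈ hs ] fromℕ (#ᴾ P)
        + (∑[ t ∈ units ] ∑[ y ∈ ps ] cos (t 𝔽.* (𝔽.1# 𝔽.- monicNormal h ∙ y))))
        ≈⟨ ∑-+ _ _ hs ⟩
      _ ≈⟨ +-cong (trans (∑-const _ hs) (*-comm _ _)) (reflexive (≡.sym (∑-map _ monicNormal hs))) ⟩
      fromℕ (#ᴾ P) * fromℕ (#ᴴ H) + deviation ps (List.map monicNormal hs) ∎
      where
      ps = points P
      hs = hyperplanes H

      detect : ∀ {h} → ¬ (offset h 𝔽.≈ 𝔽.0#) → ∀ y → fromℕ q * 𝟙 (y ∈ₕ? h) ≈
        1# + (∑[ t ∈ units ] cos (t 𝔽.* (𝔽.1# 𝔽.- monicNormal h ∙ y)))
      detect {h} b≉0 y = sym (trans (∑-units-cos _) (*-congˡ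
        (𝟙-cong (𝔽.1# 𝔽.- monicNormal h ∙ y 𝔽.≟ 𝔽.0#) (y ∈ₕ? h)
          (λ eq → monicNormal∙≈1⇒∈ₕ {h = h} b≉0 (𝔽.sym (GroupProperties.x∙y⁻¹≈ε⇒x≈y 𝔽.+-group _ _ eq)))
          (λ y∈h → 𝔽.trans (𝔽.+-congˡ (𝔽.-‿cong (∈ₕ⇒monicNormal∙≈1 {h = h} b≉0 y∈h)))
            (𝔽.-‿inverseʳ 𝔽.1#)))))

-- Real powers with quarter-integer and natural exponents

module RealPowerProperties {c ℓ₁ ℓ₂} (ℝ : RealField c ℓ₁ ℓ₂) (power : RealPower ℝ) where
  open RealField ℝ
  open RealFieldProperties ℝ
  open RealPower power
  open IntegerSolver commutativeRing
  open SetoidReasoning setoid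

  Dom-1 : ∀ {x} → Dom x 1#
  Dom-1 = inj₂ 0<1

  Dom-* : ∀ {x r} k → Dom x r → Dom x (fromℕ (suc k) * r)
  Dom-* k (inj₁ 0<x) = inj₁ 0<x
  Dom-* k (inj₂ 0<r) = inj₂ (*-positive (0<fromℕ (suc k)) 0<r)

  pow-^ : ∀ {x r} k (p : Dom x r) → 0# ≤ x →
          pow x r p ^ suc k ≈ pow x (fromℕ (suc k) * r) (Dom-* k p)
  pow-^ {x} {r} zero p 0≤x = trans (*-identityʳ _)
    (pow-cong p (Dom-* 0 p) refl (solve 1 (λ r → r := (con (+ 1) :+ con (+ 0)) :* r) refl r))
  pow-^ {x} {r} (suc k) p 0≤x = begin
    pow x r p * pow x r p ^ suc k
      ≈⟨ *-congˡ (pow-^ k p 0≤x) ⟩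
    pow x r p * pow x (fromℕ (suc k) * r) (Dom-* k p)
      ≈⟨ pow-+ p+ p (Dom-* k p) 0≤x ⟨
    pow x (r + fromℕ (suc k) * r) p+
      ≈⟨ pow-cong p+ (Dom-* (suc k) p) refl r+kr≈ ⟩
    pow x (fromℕ (suc (suc k)) * r) (Dom-* (suc k) p) ∎
    where
    r+kr≈ : r + fromℕ (suc k) * r ≈ fromℕ (suc (suc k)) * r
    r+kr≈ = solve 2 (λ r k → r :+ k :* r := (con (+ 1) :+ k) :* r) refl r (fromℕ (suc k))

    p+ : Dom x (r + fromℕ (suc k) * r)
    p+ = Sum.map₂ (<-respʳ-≈ (sym r+kr≈)) (Dom-* (suc k) p)

  root-^ : ∀ k .{{_ : ℕ.NonZero k}} {x} → 0# ≤ x → root k x ^ k ≈ x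
  root-^ (suc k) {x} 0≤x = begin
    root (suc k) x ^ suc k                             ≈⟨ pow-^ k 0<1/k 0≤x ⟩
    pow x (fromℕ (suc k) * 1/ suc k) (Dom-* k 0<1/k)   ≈⟨ pow-cong _ Dom-1 refl
                                                            (trans (*-comm _ _) (1/n*n≈1 (suc k))) ⟩
    pow x 1# Dom-1                                     ≈⟨ pow-1 Dom-1 0≤x ⟩
    x                                                  ∎
    where
    0<1/k : Dom x (1/ suc k)
    0<1/k = inj₂ (0<1/n (suc k))

  root-nonneg : ∀ k .{{_ : ℕ.NonZero k}} {x} → 0# ≤ x → 0# ≤ root k x
  root-nonneg k 0≤x = pow-nonneg _ 0≤x

  -- No law fixes the exponent 0 directly, but x = x^(0+1) = x⁰ x, and a positive x cancels.
  pow-0 : ∀ {x} (p : Dom x 0#) → 0# < x → pow x 0# p ≈ 1#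
  pow-0 {x} p 0<x = begin
    pow x 0# p               ≈⟨ x-y+y≈x _ 1# ⟨
    (pow x 0# p - 1#) + 1#   ≈⟨ +-congʳ (x#0∧xy≈0⇒y≈0 (#-sym (<⇒# 0<x)) vanishes) ⟩
    0# + 1#                  ≈⟨ +-identityˡ 1# ⟩
    1#                       ∎
    where
    x≈ : x ≈ pow x 0# p * x
    x≈ = begin
      x                               ≈⟨ pow-1 Dom-1 (<⇒≤ 0<x) ⟨
      pow x 1# Dom-1                  ≈⟨ pow-cong Dom-1 (inj₁ 0<x) refl (sym (+-identityˡ 1#)) ⟩
      pow x (0# + 1#) (inj₁ 0<x)      ≈⟨ pow-+ _ p Dom-1 (<⇒≤ 0<x) ⟩
      pow x 0# p * pow x 1# Dom-1     ≈⟨ *-congˡ (pow-1 Dom-1 (<⇒≤ 0<x)) ⟩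
      pow x 0# p * x                  ∎

    vanishes : x * (pow x 0# p - 1#) ≈ 0#
    vanishes = begin
      x * (pow x 0# p - 1#)  ≈⟨ solve 2 (λ x o → x :* (o :- con (+ 1)) := o :* x :- x) refl x _ ⟩
      pow x 0# p * x - x     ≈⟨ +-congʳ x≈ ⟨
      x - x                  ≈⟨ -‿inverseʳ x ⟩
      0#                     ∎

  pow-fromℕ : ∀ {x} k (0<x : 0# < x) → pow x (fromℕ k) (inj₁ 0<x) ≈ x ^ k
  pow-fromℕ zero    0<x = pow-0 (inj₁ 0<x) 0<x
  pow-fromℕ (suc k) 0<x = trans (pow-+ _ Dom-1 (inj₁ 0<x) (<⇒≤ 0<x))
    (*-cong (pow-1 Dom-1 (<⇒≤ 0<x)) (pow-fromℕ k 0<x))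

  ^ᵣ-nonneg : ∀ n r → 0# ≤ n ^ᵣ r
  ^ᵣ-nonneg zero    r = ≤-refl
  ^ᵣ-nonneg (suc n) r = pow-nonneg _ (0≤fromℕ (suc n))

  -- The exponents add up by `pow-^`. At base 0 both sides are the default value 0.
  ^ᵣ¼-^4 : ∀ n r → (n ^ᵣ (r * ¼)) ^ 4 ≈ n ^ᵣ r
  ^ᵣ¼-^4 zero    r = zeroˡ _
  ^ᵣ¼-^4 (suc n) r = trans (pow-^ 3 0<n (0≤fromℕ (suc n))) (pow-cong _ 0<n refl (begin
    fromℕ 4 * (r * ¼)  ≈⟨ solve 3 (λ f r q → f :* (r :* q) := r :* (q :* f)) refl (fromℕ 4) r ¼ ⟩
    r * (¼ * fromℕ 4)  ≈⟨ *-congˡ (1/n*n≈1 4) ⟩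
    r * 1#             ≈⟨ *-identityʳ r ⟩
    r                  ∎))
    where
    0<n : ∀ {r} → Dom (fromℕ (suc n)) r
    0<n = inj₁ (0<fromℕ (suc n))

  -- `¾` unfolds to `fromℕ 3 * ¼`. Base 0 does occur, for an empty set of hyperplanes.
  ^ᵣ¾-^4 : ∀ n → (n ^ᵣ ¾) ^ 4 ≈ fromℕ n ^ 3
  ^ᵣ¾-^4 zero    = trans (zeroˡ _) (sym (zeroˡ _))
  ^ᵣ¾-^4 (suc n) = trans (^ᵣ¼-^4 (suc n) (fromℕ 3)) (pow-fromℕ 3 (0<fromℕ (suc n)))

  -- The exponent is a difference of reals and not a truncated one, so d = 0 reads n⁻¹ n = 1 and
  -- needs no separate case.
  ^ᵣ-pred : ∀ n .{{_ : ℕ.NonZero n}} d → (n ^ᵣ (fromℕ d - 1#)) * fromℕ n ≈ fromℕ n ^ d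
  ^ᵣ-pred (suc n) d = begin
    pow m (fromℕ d - 1#) 0<m * m                 ≈⟨ *-congˡ (pow-1 Dom-1 (0≤fromℕ (suc n))) ⟨
    pow m (fromℕ d - 1#) 0<m * pow m 1# Dom-1    ≈⟨ pow-+ 0<m 0<m Dom-1 (0≤fromℕ (suc n)) ⟨
    pow m ((fromℕ d - 1#) + 1#) 0<m              ≈⟨ pow-cong 0<m 0<m refl (x-y+y≈x (fromℕ d) 1#) ⟩
    pow m (fromℕ d) 0<m                          ≈⟨ pow-fromℕ d (0<fromℕ (suc n)) ⟩
    m ^ d                                        ∎
    where
    m = fromℕ (suc n)
    0<m : ∀ {r} → Dom m r
    0<m = inj₁ (0<fromℕ (suc n))

  1/n^d*n^d≈1 : ∀ n .{{_ : ℕ.NonZero n}} d → (1/ n) ^ d * fromℕ n ^ d ≈ 1#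
  1/n^d*n^d≈1 n zero    = *-identityˡ 1#
  1/n^d*n^d≈1 n (suc d) = begin
    1/ n * (1/ n) ^ d * (fromℕ n * fromℕ n ^ d)
      ≈⟨ solve 4 (λ a b c e → a :* b :* (c :* e) := a :* c :* (b :* e)) refl _ _ _ _ ⟩
    1/ n * fromℕ n * ((1/ n) ^ d * fromℕ n ^ d)  ≈⟨ *-cong (1/n*n≈1 n) (1/n^d*n^d≈1 n d) ⟩
    1# * 1#                                      ≈⟨ *-identityˡ 1# ⟩
    1#                                           ∎

-- From the Salem condition to the incidence bound

module SalemBound
  {c ℓ₁ ℓ₂ a ℓ} (ℝ : RealField c ℓ₁ ℓ₂) (power : RealPower ℝ) {q : ℕ} (𝔽 : FiniteField a ℓ q)
  (character : Fourier.NontrivialAdditiveCharacter ℝ power 𝔽)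
  where
  open RealField ℝ
  open RealFieldProperties ℝ
  open RealPower power
  open RealPowerProperties ℝ power
  open FiniteSums ℝ
  open IntegerSolver commutativeRing
  open SetoidReasoning setoid
  open Fourier ℝ power 𝔽 using
    (ℂ; re; im; ∣_∣; 0ᶜ; _+ᶜ_; q⁻¹; fourier; fourierNorm₄; IsSalem₄)
  open AffineSpace 𝔽
  open CharacterSums ℝ power 𝔽 character
  open Fourier.NontrivialAdditiveCharacter character using (χ)
  private module 𝔽 = FiniteField 𝔽

  instance
    q-nonZero : ℕ.NonZero q
    q-nonZero = 𝔽.order-nonZero

  re-∑ᶜ : ∀ {b} {B : Set b} (f : B → ℂ) ys →
          re (foldr (λ y z → f y +ᶜ z) 0ᶜ ys) ≡ (∑[ y ∈ ys ] re (f y))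
  re-∑ᶜ f []       = ≡.refl
  re-∑ᶜ f (y ∷ ys) = ≡.cong (λ r → re (f y) + r) (re-∑ᶜ f ys)

  im-∑ᶜ : ∀ {b} {B : Set b} (f : B → ℂ) ys →
          im (foldr (λ y z → f y +ᶜ z) 0ᶜ ys) ≡ (∑[ y ∈ ys ] im (f y))
  im-∑ᶜ f []       = ≡.refl
  im-∑ᶜ f (y ∷ ys) = ≡.cong (λ r → im (f y) + r) (im-∑ᶜ f ys)

  ∣∣-^4 : ∀ z → ∣ z ∣ ^ 4 ≈ (re z * re z + im z * im z) * (re z * re z + im z * im z)
  ∣∣-^4 z = trans (solve 1 (λ r → r :^ 4 := r :^ 2 :* r :^ 2) refl ∣ z ∣) (*-cong eq eq)
    where
    eq : ∣ z ∣ ^ 2 ≈ re z * re z + im z * im z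
    eq = root-^ 2 (+-nonneg (0≤x*x _) (0≤x*x _))

  module _ {d : ℕ} (P : PointSet d) where

    fourthMoment : Carrier
    fourthMoment = ∑[ x ∈ nonzeroPoints d ] normTransform² (points P) x * normTransform² (points P) x

    u : Carrier
    u = q⁻¹ ^ d

    ∣fourier∣^4 : ∀ x → ∣ fourier character P x ∣ ^ 4
      ≈ u ^ 4 * (normTransform² (points P) x * normTransform² (points P) x)
    ∣fourier∣^4 x = trans (∣∣-^4 (fourier character P x)) (begin
      (z₁ * z₁ + z₂ * z₂) * (z₁ * z₁ + z₂ * z₂)
        ≡⟨ ≡.cong₂ (λ r i → (u * r * (u * r) + u * i * (u * i)) * (u * r * (u * r) + u * i * (u * i)))
             (re-∑ᶜ _ (points P)) (im-∑ᶜ _ (points P)) ⟩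
      _ ≈⟨ solve 3 (λ u r i →
             (u :* r :* (u :* r) :+ u :* i :* (u :* i)) :* (u :* r :* (u :* r) :+ u :* i :* (u :* i))
               := u :^ 4 :* ((r :* r :+ i :* i) :* (r :* r :+ i :* i))) refl u _ _ ⟩
      u ^ 4 * (normTransform² (points P) x * normTransform² (points P) x) ∎)
      where
      z₁ = re (fourier character P x)
      z₂ = im (fourier character P x)

    0≤u : 0# ≤ u
    0≤u = ^-nonneg d (<⇒≤ (0<1/n q))

    0≤M : 0# ≤ fourthMoment
    0≤M = ∑-nonneg (nonzeroPoints d) λ x → 0≤x*x _

    fourierSum≈ : (∑[ x ∈ nonzeroPoints d ] ∣ fourier character P x ∣ ^ 4) ≈ u ^ 4 * fourthMoment
    fourierSum≈ = trans (∑-cong (nonzeroPoints d) ∣fourier∣^4) (∑-*ˡ (u ^ 4) _ (nonzeroPoints d))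

    0≤norm⁴ : 0# ≤ u * (∑[ x ∈ nonzeroPoints d ] ∣ fourier character P x ∣ ^ 4)
    0≤norm⁴ = *-nonneg 0≤u (≤-respʳ-≈ (sym fourierSum≈) (*-nonneg (^-nonneg 4 0≤u) 0≤M))

    -- In the fourth power of the Salem inequality the left side carries u⁵, one `u` from the
    -- averaging in the norm and four from the transform, while the right side carries u⁴.
    -- Cancelling u⁵ leaves 1/u = q^d on the right.
    salem⇒fourthMoment≤ : ∀ {C s} → IsSalem₄ character C s P →
      fourthMoment ≤ fromℕ q ^ d * (C * (#ᴾ P ^ᵣ (1# - s))) ^ 4
    salem⇒fourthMoment≤ {C} {s} salem = *-cancelʳ-≤ 0<u⁵ (≤-respˡ-≈ (begin
      fourierNorm₄ character P ^ 4         ≈⟨ root-^ 4 0≤norm⁴ ⟩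
      u * (∑[ x ∈ nonzeroPoints d ] ∣ fourier character P x ∣ ^ 4) ≈⟨ *-congˡ fourierSum≈ ⟩
      u * (u ^ 4 * fourthMoment)           ≈⟨ solve 2 (λ u m → u :* (u :^ 4 :* m) := m :* u :^ 5) refl u _ ⟩
      fourthMoment * u ^ 5                 ∎)
      (≤-respʳ-≈ (begin
      (C * (u * W)) ^ 4                    ≈⟨ solve 3 (λ C u W → (C :* (u :* W)) :^ 4
                                                := con (+ 1) :* (C :* W) :^ 4 :* u :^ 4) refl C u W ⟩
      -- The 1 was inserted to be replaced by u q^d, which supplies the fifth factor `u`.
      1# * (C * W) ^ 4 * u ^ 4             ≈⟨ *-congʳ (*-congʳ (1/n^d*n^d≈1 q d)) ⟨
      u * fromℕ q ^ d * (C * W) ^ 4 * u ^ 4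
        ≈⟨ solve 3 (λ u k w → u :* k :* w :* u :^ 4 := k :* w :* u :^ 5) refl u (fromℕ q ^ d) _ ⟩
      fromℕ q ^ d * (C * W) ^ 4 * u ^ 5    ∎)
      (^-mono-≤ 4 (root-nonneg 4 0≤norm⁴) salem)))
      where
      W = #ᴾ P ^ᵣ (1# - s)

      0<u⁵ : 0# < u ^ 5
      0<u⁵ = ^-positive 5 (^-positive d (0<1/n q))

    deviation≤ : ∀ {C s} → 0# < C → IsSalem₄ character C s P →
      ∀ (vs : List (Point d)) → Unique.Unique (≋-setoid d) vs →
      All (λ v → ¬ (v ≋ origin d)) vs →
      deviation (points P) vs ≤ fromℕ q *
        (C * ((length vs ^ᵣ ¾) * (q ^ᵣ ((fromℕ d - 1#) * ¼)) * (#ᴾ P ^ᵣ (1# - s))))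
    deviation≤ {C} {s} 0<C salem vs vs! vs≉0 = ^-cancel-≤ 4
      (*-nonneg (0≤fromℕ q) (*-nonneg (<⇒≤ 0<C)
        (*-nonneg (*-nonneg (^ᵣ-nonneg (length vs) _) (^ᵣ-nonneg q _)) (^ᵣ-nonneg (#ᴾ P) _))))
      (≤-trans (deviation⁴≤ (points P) vs! vs≉0) (≤-trans
        (*-mono-≤ 0≤n³κ³ 0≤M ≤-refl (salem⇒fourthMoment≤ salem))
        (≤-reflexive (begin
      (n * κ) ^ 3 * (κ ^ d * (C * W) ^ 4)
        -- Writing q^d as Q⁴ q joins a fourth factor q to the three in (n κ)³, so that κ can enter
        -- the fourth power.
        ≈⟨ *-congˡ (*-congʳ (trans (*-congʳ (^ᵣ¼-^4 q _)) (^ᵣ-pred q d))) ⟨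
      (n * κ) ^ 3 * (Q ^ 4 * κ * (C * W) ^ 4)
        ≈⟨ solve 5 (λ n κ Q C W → (n :* κ) :^ 3 :* (Q :^ 4 :* κ :* (C :* W) :^ 4)
             := n :^ 3 :* (κ :* (C :* (Q :* W))) :^ 4) refl n κ Q C W ⟩
      n ^ 3 * (κ * (C * (Q * W))) ^ 4
        ≈⟨ *-congʳ (^ᵣ¾-^4 (length vs)) ⟨
      h ^ 4 * (κ * (C * (Q * W))) ^ 4
        ≈⟨ solve 5 (λ h κ Q C W → h :^ 4 :* (κ :* (C :* (Q :* W))) :^ 4
             := (κ :* (C :* (h :* Q :* W))) :^ 4) refl h κ Q C W ⟩
      (κ * (C * (h * Q * W))) ^ 4 ∎))))
      where
      n κ h Q W : Carrier
      n = fromℕ (length vs)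
      κ = fromℕ q
      h = length vs ^ᵣ ¾
      Q = q ^ᵣ ((fromℕ d - 1#) * ¼)
      W = #ᴾ P ^ᵣ (1# - s)

      0≤n³κ³ : 0# ≤ (n * κ) ^ 3
      0≤n³κ³ = ^-nonneg 3 (*-nonneg (0≤fromℕ (length vs)) (0≤fromℕ q))

    -- The exact formula for q I(P,H) is combined with the bound on the deviation, and the positive
    -- factor q is cancelled at the end.
    incidences≤ : ∀ {C s} → 0# < C → IsSalem₄ character C s P →
      (H : HyperplaneSet d) → NonzeroOffsets H →
      fromℕ (incidences P H)
        ≤ fromℕ (#ᴾ P) * fromℕ (#ᴴ H) * q⁻¹
          + C * ((#ᴴ H ^ᵣ ¾) * (q ^ᵣ ((fromℕ d - 1#) * ¼)) * (#ᴾ P ^ᵣ (1# - s)))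
    incidences≤ {C} {s} 0<C salem H bs≉0 = *-cancelʳ-≤ (0<fromℕ q) (≤-respˡ-≈
      (trans (sym (fromℕ-q*incidences P H bs≉0)) (*-comm _ _))
      (≤-respʳ-≈ (begin
      p * m + κ * (C * Y (#ᴴ H))               ≈⟨ +-congʳ (*-identityʳ (p * m)) ⟨
      p * m * 1# + κ * (C * Y (#ᴴ H))          ≈⟨ +-congʳ (*-congˡ (1/n*n≈1 q)) ⟨
      p * m * (q⁻¹ * κ) + κ * (C * Y (#ᴴ H))
        ≈⟨ solve 4 (λ x r κ y → x :* (r :* κ) :+ κ :* y := (x :* r :+ y) :* κ) refl (p * m) q⁻¹ κ _ ⟩
      (p * m * q⁻¹ + C * Y (#ᴴ H)) * κ         ∎)
      (+-mono-≤ ≤-refl (≡.subst (λ k → deviation (points P) vs ≤ κ * (C * Y k))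
        (List.length-map monicNormal (hyperplanes H))
        (deviation≤ 0<C salem vs (monicNormals-unique bs≉0 (HyperplaneSet.distinct H))
          (All.map⁺ (All.map (λ {h} → monicNormal-nonorigin {h = h}) bs≉0)))))))
      where
      open FiniteFieldProperties 𝔽
      p m κ : Carrier
      p = fromℕ (#ᴾ P)
      m = fromℕ (#ᴴ H)
      κ = fromℕ q

      Y : ℕ → Carrier
      Y k = (k ^ᵣ ¾) * (q ^ᵣ ((fromℕ d - 1#) * ¼)) * (#ᴾ P ^ᵣ (1# - s))

      vs : List (Point d)
      vs = List.map monicNormal (hyperplanes H)

theorem41 : ∀ {c ℓ₁ ℓ₂ a ℓ : Level}
    (ℝ : RealField c ℓ₁ ℓ₂) (power : RealPower ℝ)
    (q : ℕ) (𝔽 : FiniteField a ℓ q) →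
    let open Fourier ℝ power 𝔽 in
    (χ : NontrivialAdditiveCharacter)
    (C : Real) → 0# < C →
    (s : Real) → ¼ ≤ s → s ≤ ½ →
    (d : ℕ) (P : PointSet d) → IsSalem₄ χ C s P →
    (H : HyperplaneSet d) → NonzeroOffsets H →
    fromℕ (incidences P H)
    ≤ fromℕ (#ᴾ P) * fromℕ (#ᴴ H) * q⁻¹
    + C * ((#ᴴ H ^ᵣ ¾) * (q ^ᵣ ((fromℕ d - 1#) * ¼)) * (#ᴾ P ^ᵣ (1# - s)))
theorem41 ℝ power q 𝔽 χ C 0<C s _ _ d P salem H bs≉0 =
  SalemBound.incidences≤ ℝ power 𝔽 χ P {s = s} 0<C salem H bs≉0
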